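{- Let $G$ be a finite abstract simplicial complex with Dirac matrix $D_G$. If $K\subset G$ is a subcomplex of $G$, then the eigenvalues of $D_K$ interlace the eigenvalues of $D_G$. The same holds if $K$ is replaced by an open set $U\subset G$, that is, the eigenvalues of $D_U$ interlace the eigenvalues of $D_G$.
   Context: A finite abstract simplicial complex $G$ is a finite set of non-empty finite sets (simplices) closed under taking non-empty subsets. A subcomplex is a subset $K\subset G$ that is itself closed under taking non-empty subsets. A set $U\subset G$ is open if $x\in U$, $y\in G$, $x\subset y$ imply $y\in U$. Fix an ordering of the vertices of each simplex. For $y\subset x$ with $|x|=|y|+1$, $\mathrm{sign}(x,y)\in\{1,-1\}$ is the sign of the permutation that takes the list $(v,y)$ ($v$ the vertex in $x\setminus y$, followed by the ordered vertices of $y$) to the ordered list of vertices of $x$. The exterior derivative $d$ is the matrix indexed by $G\times G$ with $d(x,y)=\mathrm{sign}(x,y)$ if $y\subset x$ and $|x|=|y|+1$, and $d(x,y)=0$ otherwise. The Dirac matrix is $D_G=d+d^*$, with $d^*$ the transpose. For a subset $A\subset G$ that is a subcomplex or open, $D_A$ is the matrix defined by the same formula with rows and columns indexed by $A$ (using the same vertex orderings). Interlacing, in the sense of the Cauchy interlace theorem: if $|G|=n$, $|A|=m$, $\lambda_1\le\cdots\le\lambda_n$ are the eigenvalues of $D_G$ and $\mu_1\le\cdots\le\mu_m$ those of $D_A$ (with multiplicity), then $\lambda_k\le\mu_k\le\lambda_{k+n-m}$ for all $1\le k\le m$. -}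

module Defs where

open import Level as Level using (_⊔_)
open import Algebra.Apartness.Bundles using (HeytingField; HeytingCommutativeRing)
open import Algebra.Bundles using (CommutativeRing; Semiring)
import Algebra.Definitions.RawSemiring as RawSemiringDefinitions
open import Data.Bool.Base using (_∧_; if_then_else_)
open import Data.Fin.Base as Fin using (Fin; zero; suc; toℕ; inject≤; cast; _↑ʳ_)
import Data.Fin.Properties as Fin
open import Data.Fin.Subset using (Subset; inside; outside; _∈_; _⊆_; ∣_∣; Nonempty)
open import Data.Fin.Subset.Properties using (_∈?_; _⊆?_)
open import Data.Integer.Base as ℤ using (ℤ; +_; -[1+_]; 0ℤ; 1ℤ; -1ℤ)
open import Data.List.Base using (List; []; _∷_; _++_; filter; length; map)
import Data.List.Membership.Propositional as List
open import Data.List.Relation.Unary.Unique.Propositional using (Unique)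
open import Data.Nat.Base as ℕ using (ℕ; zero; suc; _∸_)
import Data.Nat.Properties as ℕ
open import Data.Product.Base using (∃-syntax; _×_)
open import Data.Sum.Base using (_⊎_)
open import Data.Vec.Base using ([]; _∷_)
open import Data.Vec.Functional using (Vector; removeAt)
open import Function.Base using (id)
open import Function.Bundles using (_⇔_)
open import Function.Definitions using (Injective)
open import Relation.Binary.Core using (Rel)
open import Relation.Binary.PropositionalEquality.Core using (_≡_)
open import Relation.Binary.Structures using (IsStrictPartialOrder)
open import Relation.Nullary.Decidable.Core using (does; ¬?)
open import Relation.Nullary.Negation.Core using (¬_)

private
  variable
    m n N : ℕ

------------------------------------------------------------------------
-- Ordered fields

-- The apartness x # y is "x < y or y < x" and equality is tight, so every
-- classical ordered field is a model, and so are the constructive (Cauchy or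
-- Dedekind) real numbers, whose order is not decidable.

record OrderedField c ℓ₁ ℓ₂ ℓ₃ : Set (Level.suc (c ⊔ ℓ₁ ⊔ ℓ₂ ⊔ ℓ₃)) where
  field
    heytingField : HeytingField c ℓ₁ ℓ₂

  open HeytingField heytingField public

  infix 4 _<_ _≤_

  field
    _<_                  : Rel Carrier ℓ₃
    isStrictPartialOrder : IsStrictPartialOrder _≈_ _<_
    <⇒#                  : ∀ {x y} → x < y → x # y
    #⇒<⊎>                : ∀ {x y} → x # y → x < y ⊎ y < x
    +-monoʳ-<            : ∀ z {x y} → x < y → z + x < z + y
    *-pos                : ∀ {x y} → 0# < x → 0# < y → 0# < x * y

  _≤_ : Rel Carrier ℓ₃
  x ≤ y = ¬ (y < x)

  commutativeRing : CommutativeRing c ℓ₁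
  commutativeRing = HeytingCommutativeRing.commutativeRing heytingCommutativeRing

Matrix : ∀ {a} → Set a → ℕ → Set a
Matrix A n = Fin n → Fin n → A

------------------------------------------------------------------------
-- Eigenvalues of integer matrices in an ordered field

module Eigenvalues {c ℓ₁ ℓ₂ ℓ₃} (F : OrderedField c ℓ₁ ℓ₂ ℓ₃) where
  open OrderedField F hiding (zero)
  open RawSemiringDefinitions (Semiring.rawSemiring (CommutativeRing.semiring commutativeRing))
    using (sum; product; _^_) renaming (_×_ to _·_)

  fromℤ : ℤ → Carrier
  fromℤ (+ n)    = n · 1#
  fromℤ -[1+ n ] = - (ℕ.suc n · 1#)

  -- Laplace expansion along the first row.
  det : Matrix Carrier n → Carrier
  det {zero}  M = 1#
  det {suc n} M =
    sum λ j → (- 1#) ^ toℕ j * (M zero j * det λ i → removeAt (M (suc i)) j)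

  scalar : Carrier → Matrix Carrier n
  scalar t i j = if does (i Fin.≟ j) then t else 0#

  charPoly : Matrix ℤ n → Carrier → Carrier
  charPoly M t = det λ i j → scalar t i j - fromℤ (M i j)

  -- The entries of ev are all eigenvalues of M, listed in nondecreasing order
  -- and with multiplicity.  An ordered field is infinite, so agreement of the
  -- two monic polynomials at every t is equality of polynomials.
  record AreEigenvalues (M : Matrix ℤ n) (ev : Vector Carrier n)
         : Set (c ⊔ ℓ₁ ⊔ ℓ₃) where
    field
      nondecreasing : ∀ {i j} → i Fin.≤ j → ev i ≤ ev j
      splits        : ∀ t → charPoly M t ≈ product λ i → t - ev i

  -- νₖ ≤ μₖ ≤ νₖ₊ₙ₋ₘ, with k counted from 0.
  Interlaces : m ℕ.≤ n → Vector Carrier m → Vector Carrier n → Set ℓ₃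
  Interlaces {m} {n} m≤n μ ν = ∀ (k : Fin m) →
    ν (inject≤ k m≤n) ≤ μ k ×
    μ k ≤ ν (cast (ℕ.m∸n+n≡m m≤n) ((n ∸ m) ↑ʳ k))

  EigenvaluesInterlace : m ℕ.≤ n → Matrix ℤ m → Matrix ℤ n → Set (c ⊔ ℓ₁ ⊔ ℓ₃)
  EigenvaluesInterlace m≤n A B = ∀ μ ν →
    AreEigenvalues A μ → AreEigenvalues B ν → Interlaces m≤n μ ν

open Eigenvalues public using (EigenvaluesInterlace)

------------------------------------------------------------------------
-- Simplicial complexes

-- A complex with n simplices, whose vertices are among N labels.
record SimplicialComplex (N n : ℕ) : Set where
  field
    simplex   : Fin n → Subset N
    injective : Injective _≡_ _≡_ simplex
    nonempty  : ∀ i → Nonempty (simplex i)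
    closed    : ∀ {i y} → Nonempty y → y ⊆ simplex i → ∃[ j ] simplex j ≡ y

-- Subsets of a complex are given by their sets of indices.
module _ (G : SimplicialComplex N n) where
  open SimplicialComplex G

  IsSubcomplex : Subset n → Set
  IsSubcomplex K = ∀ {i y} → i ∈ K → Nonempty y → y ⊆ simplex i →
                   ∃[ j ] j ∈ K × simplex j ≡ y

  IsOpen : Subset n → Set
  IsOpen U = ∀ {i j} → i ∈ U → simplex i ⊆ simplex j → j ∈ U

  -- The orderings of different simplices need not be compatible.
  record VertexOrderings : Set where
    field
      order     : Fin n → List (Fin N)
      unique    : ∀ i → Unique (order i)
      ∈-order⇔∈ : ∀ i {v} → v List.∈ order i ⇔ v ∈ simplex i

------------------------------------------------------------------------
-- The Dirac matrix

position : Fin N → List (Fin N) → ℕ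
position v []       = 0
position v (w ∷ ws) = if does (v Fin.≟ w) then 0 else ℕ.suc (position v ws)

inversions : List ℕ → ℕ
inversions []       = 0
inversions (p ∷ ps) = length (filter (ℕ._<? p) ps) ℕ.+ inversions ps

-- For duplicate-free lists with the same entries, the sign of the permutation
-- taking the first list to the second.
permutationSign : List (Fin N) → List (Fin N) → ℤ
permutationSign vs ws = -1ℤ ℤ.^ inversions (map (λ v → position v ws) vs)

module _ {G : SimplicialComplex N n} (o : VertexOrderings G) where
  open SimplicialComplex G
  open VertexOrderings o

  -- If simplex i has exactly one vertex v outside simplex j, the filter
  -- returns the list consisting of v alone.
  sign : Fin n → Fin n → ℤ
  sign i j = permutationSign
    (filter (λ v → ¬? (v ∈? simplex j)) (order i) ++ order j) (order i)

  d : Matrix ℤ n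
  d i j = if does (simplex j ⊆? simplex i)
             ∧ does (∣ simplex i ∣ ℕ.≟ ℕ.suc ∣ simplex j ∣)
          then sign i j else 0ℤ

  -- The Dirac matrix of a family of simplices, given by indices.
  diracOf : (Fin m → Fin n) → Matrix ℤ m
  diracOf ι a b = d (ι a) (ι b) ℤ.+ d (ι b) (ι a)

-- The elements of a subset, in increasing order.
elements : (A : Subset n) → Fin ∣ A ∣ → Fin n
elements (inside  ∷ A) zero    = zero
elements (inside  ∷ A) (suc a) = suc (elements A a)
elements (outside ∷ A) a       = suc (elements A a)

module _ {G : SimplicialComplex N n} (o : VertexOrderings G) where

  dirac : Matrix ℤ n
  dirac = diracOf o id

  diracOn : (A : Subset n) → Matrix ℤ ∣ A ∣
  diracOn A = diracOf o (elements A)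

{-# OPTIONS --safe #-}
module Submission where

-- D_A is a principal submatrix of the symmetric matrix D_G, so this is Cauchy
-- interlacing.  The eigenvalues need not exist for intermediate submatrices, so
-- rows cannot be deleted one at a time; instead the splitting of det (t − M) is
-- turned into a basis of orthogonal eigenvectors by deflation: a kernel vector v
-- of λ − M is split off, the determinant of the form t⟨·,·⟩ − M on the complement
-- of v is, up to a constant, the old one divided by t − λ, and iteration
-- exhausts the roots.  If an inequality λₖ ≤ μₖ ≤ λₖ₊ₙ₋ₘ failed, then for some s
-- the form s⟨·,·⟩ − D_G would be positive on a span of eigenvectors of one matrix
-- and nonpositive on a span of eigenvectors of the other, with dimensions adding
-- up to n + 1.  All inequalities to be proved are negations, so existence
-- statements are only needed up to double negation, where case distinctions on
-- x # 0 are available.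

-- Two constraints shape the deflation. An ordered field need not contain square roots, so
-- eigenvectors stay unnormalised, and each Gram determinant equals the product of the remaining
-- linear factors only up to a constant `a # 0#`. And `t - λ` can be divided out only where it is
-- invertible, while a repeated root needs the quotient identity at `t = λ` itself; the factor is
-- therefore cancelled between polynomial functions, which vanish everywhere once they vanish on a
-- ray. D_A and D_G are both read in n-space: D_A is the form of D_G restricted to the coordinate
-- vectors of A, and its eigenvectors are eigenvectors only relative to that subspace. Orthogonality
-- for both forms at once makes s⟨·,·⟩ - D_G diagonal on either family, for every s.

open import Defs
open import Level using (_⊔_)
open import Algebra.Bundles using (CommutativeRing; Semiring)
import Algebra.Apartness.Properties.HeytingCommutativeRing
import Algebra.Definitions.RawSemiring as RawSemiringDefinitions
import Algebra.Properties.CommutativeSemigroup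
import Algebra.Properties.Ring
import Algebra.Properties.Semiring.Mult.TCOptimised
import Algebra.Properties.Semiring.Sum
import Algebra.Solver.Ring
open import Algebra.Solver.Ring.AlmostCommutativeRing using (_-Raw-AlmostCommutative⟶_; fromCommutativeRing)
open import Data.Empty using (⊥)
open import Data.Fin.Base as Fin
  using (Fin; zero; suc; toℕ; punchIn; splitAt; inject≤; cast; _↑ˡ_; _↑ʳ_)
open import Data.Fin.Properties
  using (_≟_; punchInᵢ≢i; suc-injective; toℕ-injective; toℕ-inject≤; toℕ-cast; toℕ-↑ʳ; toℕ<n; toℕ≤pred[n];
         splitAt⁻¹-↑ˡ; splitAt⁻¹-↑ʳ)
open import Data.Fin.Subset using (Subset; inside; outside)
open import Data.Fin.Subset.Properties using (∣p∣≤n)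
open import Data.Integer.Base as ℤ using (ℤ; +_; -[1+_]; 0ℤ; 1ℤ)
import Data.Integer.Properties as ℤ
open import Data.List.Base using (List; []; _∷_; allFin)
open import Data.List.Membership.Propositional using (_∈_; _∉_)
open import Data.List.Membership.Propositional.Properties using (∈-allFin)
open import Data.List.Relation.Unary.Any using (here; there)
open import Data.Bool.Base using (if_then_else_)
import Data.Maybe.Base as Maybe
open import Data.Nat.Base as ℕ using (ℕ; suc; _∸_)
import Data.Nat.Properties as ℕ
open import Data.Product.Base using (∃-syntax; _×_; _,_; proj₁; proj₂)
open import Data.Sign.Base as Sign using (Sign)
open import Data.Sum.Base using (_⊎_; inj₁; inj₂; [_,_]′)
open import Data.Vec.Base using ([]; _∷_)
open import Data.Vec.Functional as Vector using (Vector; _++_; updateAt; insertAt)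
open import Data.Vec.Functional.Properties
  using (lookup-++ˡ; lookup-++ʳ; updateAt-updates; updateAt-minimal; insertAt-lookup; insertAt-punchIn)
open import Function.Base using (_∘_; id; const; flip)
open import Function.Definitions using (Injective)
open import Relation.Binary.Consequences using (dec⇒weaklyDec)
open import Relation.Binary.PropositionalEquality.Core as ≡ using (_≡_; _≢_)
import Relation.Binary.PropositionalEquality.Properties as ≡
import Relation.Binary.Reasoning.Setoid
open import Relation.Binary.Structures using (IsStrictPartialOrder)
open import Relation.Nullary.Decidable.Core using (yes; no; does)
open import Relation.Nullary.Negation.Core using (¬_; contradiction)

-- With coefficients in R itself the solver could not cancel terms, as equality
-- in R is undecidable.
module IntegerCoefficients {c ℓ} (R : CommutativeRing c ℓ) where
  open CommutativeRing R
  open Algebra.Properties.Ring ring using (-0#≈0#; -‿+-comm; -‿involutive; -1*x≈-x; -‿distribˡ-*)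
  open Algebra.Properties.Semiring.Mult.TCOptimised semiring
    using (×-homo-+; ×1-homo-*) renaming (_×_ to _·_)
  open Algebra.Properties.CommutativeSemigroup *-commutativeSemigroup using (interchange)
  open Relation.Binary.Reasoning.Setoid setoid

  ⟦_⟧ : ℤ → Carrier
  ⟦ + n ⟧      = n · 1#
  ⟦ -[1+ n ] ⟧ = - (suc n · 1#)

  ⟦-⟧ : ∀ i → ⟦ ℤ.- i ⟧ ≈ - ⟦ i ⟧
  ⟦-⟧ (+ 0)      = sym -0#≈0#
  ⟦-⟧ (+ suc n)  = refl
  ⟦-⟧ -[1+ n ]   = sym (-‿involutive _)

  ⟦⊖⟧ : ∀ m n → ⟦ m ℤ.⊖ n ⟧ ≈ m · 1# - n · 1#
  ⟦⊖⟧ m 0 = trans (sym (+-identityʳ _)) (+-congˡ (sym -0#≈0#))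
  ⟦⊖⟧ 0 (suc n) = sym (+-identityˡ _)
  ⟦⊖⟧ (suc m) (suc n) = begin
    ⟦ suc m ℤ.⊖ suc n ⟧                        ≡⟨ ≡.cong ⟦_⟧ (ℤ.[1+m]⊖[1+n]≡m⊖n m n) ⟩
    ⟦ m ℤ.⊖ n ⟧                                ≈⟨ ⟦⊖⟧ m n ⟩
    m · 1# - n · 1#                            ≈⟨ +-congʳ (+-identityʳ _) ⟨
    m · 1# + 0# - n · 1#                       ≈⟨ +-congʳ (+-congˡ (-‿inverseʳ 1#)) ⟨
    m · 1# + (1# - 1#) - n · 1#                ≈⟨ +-congʳ (+-assoc _ _ _) ⟨
    m · 1# + 1# - 1# - n · 1#                  ≈⟨ +-assoc _ _ _ ⟩
    m · 1# + 1# + (- 1# - n · 1#)              ≈⟨ +-cong (+-comm _ _) (-‿+-comm _ _) ⟩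
    1# + m · 1# - (1# + n · 1#)                ≈⟨ +-cong (×-homo-+ 1# 1 m) (-‿cong (×-homo-+ 1# 1 n)) ⟨
    suc m · 1# - suc n · 1#                    ∎

  ⟦+⟧ : ∀ i j → ⟦ i ℤ.+ j ⟧ ≈ ⟦ i ⟧ + ⟦ j ⟧
  ⟦+⟧ (+ m)    (+ n)    = ×-homo-+ 1# m n
  ⟦+⟧ (+ m)    -[1+ n ] = ⟦⊖⟧ m (suc n)
  ⟦+⟧ -[1+ m ] (+ n)    = trans (⟦⊖⟧ n (suc m)) (+-comm _ _)
  ⟦+⟧ -[1+ m ] -[1+ n ] = begin
    - (suc (suc (m ℕ.+ n)) · 1#)     ≡⟨ ≡.cong (λ k → - (k · 1#)) (ℕ.+-suc (suc m) n) ⟨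
    - ((suc m ℕ.+ suc n) · 1#)       ≈⟨ -‿cong (×-homo-+ 1# (suc m) (suc n)) ⟩
    - (suc m · 1# + suc n · 1#)      ≈⟨ -‿+-comm _ _ ⟨
    - (suc m · 1#) - (suc n · 1#)    ∎

  ⟦_⟧ₛ : Sign → Carrier
  ⟦ Sign.+ ⟧ₛ = 1#
  ⟦ Sign.- ⟧ₛ = - 1#

  ⟦*⟧ₛ : ∀ s t → ⟦ s Sign.* t ⟧ₛ ≈ ⟦ s ⟧ₛ * ⟦ t ⟧ₛ
  ⟦*⟧ₛ Sign.+ t      = sym (*-identityˡ _)
  ⟦*⟧ₛ Sign.- Sign.+ = sym (*-identityʳ _)
  ⟦*⟧ₛ Sign.- Sign.- = sym (trans (-1*x≈-x _) (-‿involutive 1#))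

  ⟦◃⟧ : ∀ s n → ⟦ s ℤ.◃ n ⟧ ≈ ⟦ s ⟧ₛ * (n · 1#)
  ⟦◃⟧ s      0       = sym (zeroʳ _)
  ⟦◃⟧ Sign.+ (suc n) = sym (*-identityˡ _)
  ⟦◃⟧ Sign.- (suc n) = sym (-1*x≈-x _)

  ⟦⟧-signAbs : ∀ i → ⟦ i ⟧ ≈ ⟦ ℤ.sign i ⟧ₛ * (ℤ.∣ i ∣ · 1#)
  ⟦⟧-signAbs i = trans (reflexive (≡.cong ⟦_⟧ (≡.sym (ℤ.◃-inverse i)))) (⟦◃⟧ (ℤ.sign i) ℤ.∣ i ∣)

  -- Integer multiplication is computed from signs and absolute values, so multiplicativity is
  -- checked on these two factors separately.
  ⟦*⟧ : ∀ i j → ⟦ i ℤ.* j ⟧ ≈ ⟦ i ⟧ * ⟦ j ⟧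
  ⟦*⟧ i j = begin
    ⟦ i ℤ.* j ⟧
      ≈⟨ ⟦◃⟧ (ℤ.sign i Sign.* ℤ.sign j) (ℤ.∣ i ∣ ℕ.* ℤ.∣ j ∣) ⟩
    ⟦ ℤ.sign i Sign.* ℤ.sign j ⟧ₛ * ((ℤ.∣ i ∣ ℕ.* ℤ.∣ j ∣) · 1#)
      ≈⟨ *-cong (⟦*⟧ₛ (ℤ.sign i) (ℤ.sign j)) (×1-homo-* ℤ.∣ i ∣ ℤ.∣ j ∣) ⟩
    (⟦ ℤ.sign i ⟧ₛ * ⟦ ℤ.sign j ⟧ₛ) * ((ℤ.∣ i ∣ · 1#) * (ℤ.∣ j ∣ · 1#))
      ≈⟨ interchange _ _ _ _ ⟩
    (⟦ ℤ.sign i ⟧ₛ * (ℤ.∣ i ∣ · 1#)) * (⟦ ℤ.sign j ⟧ₛ * (ℤ.∣ j ∣ · 1#))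
      ≈⟨ *-cong (⟦⟧-signAbs i) (⟦⟧-signAbs j) ⟨
    ⟦ i ⟧ * ⟦ j ⟧ ∎

  ℤ-homomorphism : ℤ.+-*-rawRing -Raw-AlmostCommutative⟶ fromCommutativeRing R
  ℤ-homomorphism = record
    { ⟦_⟧ = ⟦_⟧ ; +-homo = ⟦+⟧ ; *-homo = ⟦*⟧ ; -‿homo = ⟦-⟧ ; 0-homo = refl ; 1-homo = refl }

  open Algebra.Solver.Ring ℤ.+-*-rawRing (fromCommutativeRing R) ℤ-homomorphism
    (λ i j → Maybe.map (reflexive ∘ ≡.cong ⟦_⟧) (dec⇒weaklyDec ℤ._≟_ i j))
    public using (solve; _:+_; _:*_; _:-_; :-_; con; _:=_)

-- Ordered fields: finite sums, positivity, case distinctions up to double negation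

module Field {c ℓ₁ ℓ₂ ℓ₃} (F : OrderedField c ℓ₁ ℓ₂ ℓ₃) where
  open OrderedField F public hiding (zero)
  open CommutativeRing commutativeRing public using (ring; semiring)
  open Algebra.Properties.Semiring.Sum semiring
    using (sum; sum-cong-≋; sum-remove; ∑-distrib-+; ∑-comm; *-distribˡ-sum)
  open Algebra.Properties.Ring ring public using (-0#≈0#; -‿involutive; -1*x≈-x; -‿distribˡ-*)
  open Algebra.Apartness.Properties.HeytingCommutativeRing heytingCommutativeRing public
    using (1#0; x#0y#0→xy#0; #-congʳ)
  open Relation.Binary.Reasoning.Setoid setoid public

  open IntegerCoefficients commutativeRing public using (solve; _:+_; _:*_; _:-_; :-_; con; _:=_)
  module SPO = IsStrictPartialOrder isStrictPartialOrder

  -- Tightness turns a refutation of apartness into equality, so refuting the first alternative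
  -- already yields the second.
  #0-or-≈0 : ∀ x → ¬ ¬ (x # 0# ⊎ x ≈ 0#)
  #0-or-≈0 x k = k (inj₂ (proj₁ (tight x 0#) (k ∘ inj₁)))

  vector-#0-or-≈0 : ∀ {n} (x : Fin n → Carrier) → ¬ ¬ ((∃[ i ] x i # 0#) ⊎ (∀ i → x i ≈ 0#))
  vector-#0-or-≈0 x k = k (inj₂ λ i → proj₁ (tight (x i) 0#) (λ p → k (inj₁ (i , p))))

  inverse : ∀ {x} → x # 0# → ∃[ y ] x * y ≈ 1#
  inverse {x} x#0 with #⇒invertible x#0
  ... | y , _ , r = y , trans (*-congʳ (sym (trans (+-congˡ -0#≈0#) (+-identityʳ x)))) r

  *-cancel-#0 : ∀ {x y} → x # 0# → x * y ≈ 0# → y ≈ 0#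
  *-cancel-#0 {x} {y} x#0 xy≈0 with inverse x#0
  ... | z , xz≈1 = begin
    y            ≈⟨ *-identityˡ y ⟨
    1# * y       ≈⟨ *-congʳ xz≈1 ⟨
    x * z * y    ≈⟨ solve 3 (λ x y z → x :* z :* y := z :* (x :* y)) refl x y z ⟩
    z * (x * y)  ≈⟨ *-congˡ xy≈0 ⟩
    z * 0#       ≈⟨ zeroʳ z ⟩
    0#           ∎

  inverse-#0 : ∀ {x y} → x * y ≈ 1# → y # 0#
  inverse-#0 {x} {y} xy≈1 = invertible⇒# (x , trans lem xy≈1 , trans (*-comm _ _) (trans lem xy≈1))
    where
    lem : x * (y - 0#) ≈ x * y
    lem = *-congˡ (trans (+-congˡ -0#≈0#) (+-identityʳ y))

  -- Abstract, because sum unfolds on suc n and then blocks unification.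
  abstract
    ∑ : ∀ {n} → (Fin n → Carrier) → Carrier
    ∑ = sum

    ∑≈sum : ∀ {n} (f : Fin n → Carrier) → ∑ f ≈ sum f
    ∑≈sum f = refl

    ∑-empty : {f : Fin 0 → Carrier} → ∑ f ≈ 0#
    ∑-empty = refl

    ∑-suc : ∀ {n} {f : Fin (suc n) → Carrier} → ∑ f ≈ f zero + ∑ (f ∘ suc)
    ∑-suc = refl

    ∑-cong : ∀ {n} {f g : Fin n → Carrier} → (∀ i → f i ≈ g i) → ∑ f ≈ ∑ g
    ∑-cong = sum-cong-≋

    ∑-remove : ∀ {n} {f : Fin (suc n) → Carrier} p → ∑ f ≈ f p + ∑ (f ∘ punchIn p)
    ∑-remove {f = f} p = sum-remove {i = p} f

    ∑-+ : ∀ {n} {f g : Fin n → Carrier} → ∑ (λ i → f i + g i) ≈ ∑ f + ∑ g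
    ∑-+ {f = f} {g} = ∑-distrib-+ f g

    ∑-swap : ∀ {m n} {f : Fin m → Fin n → Carrier} →
      ∑ (λ i → ∑ (λ j → f i j)) ≈ ∑ (λ j → ∑ (λ i → f i j))
    ∑-swap {f = f} = ∑-comm f

    *-∑ : ∀ {n} x {f : Fin n → Carrier} → x * ∑ f ≈ ∑ (λ i → x * f i)
    *-∑ x {f} = *-distribˡ-sum x f

  ∑-zero : ∀ {n} {f : Fin n → Carrier} → (∀ i → f i ≈ 0#) → ∑ f ≈ 0#
  ∑-zero {0}     z = ∑-empty
  ∑-zero {suc n} z = trans ∑-suc (trans (+-cong (z zero) (∑-zero (z ∘ suc))) (+-identityˡ 0#))

  ∑-single : ∀ {n} (p : Fin n) {f : Fin n → Carrier} → (∀ i → i ≢ p → f i ≈ 0#) → ∑ f ≈ f p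
  ∑-single {suc n} p z = trans (∑-remove p)
    (trans (+-congˡ (∑-zero (λ i → z (punchIn p i) (punchInᵢ≢i p i)))) (+-identityʳ _))

  ∑-linear : ∀ {n} x y {f g : Fin n → Carrier} →
    ∑ (λ i → x * f i + y * g i) ≈ x * ∑ f + y * ∑ g
  ∑-linear x y = trans ∑-+ (sym (+-cong (*-∑ x) (*-∑ y)))

  <-resp-≈ : ∀ {x x′ y y′} → x ≈ x′ → y ≈ y′ → x < y → x′ < y′
  <-resp-≈ e f = proj₁ SPO.<-resp-≈ f ∘ proj₂ SPO.<-resp-≈ e

  neg-<0 : ∀ {x} → x < 0# → 0# < - x
  neg-<0 {x} x<0 = <-resp-≈ (-‿inverseˡ x) (+-identityʳ _) (+-monoʳ-< (- x) x<0)

  sub-pos : ∀ {x y} → x < y → 0# < y - x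
  sub-pos {x} {y} x<y = <-resp-≈ (-‿inverseˡ x) (+-comm _ _) (+-monoʳ-< (- x) x<y)

  +-pos : ∀ {x y} → 0# < x → 0# < y → 0# < x + y
  +-pos {x} 0<x 0<y = SPO.trans 0<x (<-resp-≈ (+-identityʳ x) refl (+-monoʳ-< x 0<y))

  square-pos : ∀ {x} → x # 0# → 0# < x * x
  square-pos {x} x#0 with #⇒<⊎> x#0
  ... | inj₂ 0<x = *-pos 0<x 0<x
  ... | inj₁ x<0 = <-resp-≈ refl (solve 1 (λ x → :- x :* :- x := x :* x)
          refl x) (*-pos (neg-<0 x<0) (neg-<0 x<0))

  0<1 : 0# < 1#
  0<1 = <-resp-≈ refl (*-identityˡ 1#) (square-pos 1#0)

  0≤⇒ : ∀ {x} → 0# ≤ x → ¬ ¬ (0# < x ⊎ x ≈ 0#)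
  0≤⇒ {x} 0≤x k = #0-or-≈0 x λ where
    (inj₂ e) → k (inj₂ e)
    (inj₁ a) → [ 0≤x , k ∘ inj₁ ]′ (#⇒<⊎> a)

  ≤-resp-≈ : ∀ {x x′ y y′} → x ≈ x′ → y ≈ y′ → x ≤ y → x′ ≤ y′
  ≤-resp-≈ e f p q = p (<-resp-≈ (sym f) (sym e) q)

  0<⇒0≤ : ∀ {x} → 0# < x → 0# ≤ x
  0<⇒0≤ p q = SPO.irrefl refl (SPO.trans p q)

  ≈0⇒0≤ : ∀ {x} → x ≈ 0# → 0# ≤ x
  ≈0⇒0≤ p q = SPO.irrefl p q

  +-nonneg : ∀ {x y} → 0# ≤ x → 0# ≤ y → 0# ≤ x + y
  +-nonneg {x} {y} p q r = 0≤⇒ p λ where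
    (inj₂ e) → q (<-resp-≈ (trans (+-congʳ e) (+-identityˡ y)) refl r)
    (inj₁ a) → 0≤⇒ q λ where
      (inj₂ e) → p (<-resp-≈ (trans (+-congˡ e) (+-identityʳ x)) refl r)
      (inj₁ b) → 0<⇒0≤ (+-pos a b) r

  *-nonneg : ∀ {x y} → 0# ≤ x → 0# ≤ y → 0# ≤ x * y
  *-nonneg {x} {y} p q r = 0≤⇒ p λ where
    (inj₂ e) → ≈0⇒0≤ (trans (*-congʳ e) (zeroˡ y)) r
    (inj₁ a) → 0≤⇒ q λ where
      (inj₂ e) → ≈0⇒0≤ (trans (*-congˡ e) (zeroʳ x)) r
      (inj₁ b) → 0<⇒0≤ (*-pos a b) r

  square-nonneg : ∀ x → 0# ≤ x * x
  square-nonneg x r = #0-or-≈0 x λ where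
    (inj₁ a) → 0<⇒0≤ (square-pos a) r
    (inj₂ e) → ≈0⇒0≤ (trans (*-congʳ e) (zeroˡ x)) r

  ∑-nonneg : ∀ {n} {f : Fin n → Carrier} → (∀ i → 0# ≤ f i) → 0# ≤ ∑ f
  ∑-nonneg {0}     p = ≈0⇒0≤ ∑-empty
  ∑-nonneg {suc n} p = ≤-resp-≈ refl (sym ∑-suc) (+-nonneg (p zero) (∑-nonneg (p ∘ suc)))

  ∑-pos : ∀ {n} {f : Fin n → Carrier} → (∀ i → 0# ≤ f i) → ∀ p → 0# < f p → ¬ ¬ (0# < ∑ f)
  ∑-pos {suc n} {f} nonneg p 0<fp k =
    0≤⇒ (∑-nonneg (λ i → nonneg (punchIn p i))) λ where
      (inj₁ b) → k (<-resp-≈ refl (sym (∑-remove p)) (+-pos 0<fp b))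
      (inj₂ e) → k (<-resp-≈ refl (sym (trans (∑-remove p) (trans (+-congˡ e) (+-identityʳ _)))) 0<fp)

  sub-nonneg : ∀ {x y} → x ≤ y → 0# ≤ y - x
  sub-nonneg {x} {y} p q = p (<-resp-≈ (solve 2 (λ x y → x :+ (y :- x) := y)
          refl x y) (+-identityʳ x) (+-monoʳ-< x q))

-- The dimension count behind the upper bound: m - k eigenvectors of the submatrix against index (n
-- - m) + k of the full matrix.
[m∸k]+[[n∸m]+k]≡n : ∀ {k m n} → k ℕ.≤ m → m ℕ.≤ n → (m ∸ k) ℕ.+ ((n ∸ m) ℕ.+ k) ≡ n
[m∸k]+[[n∸m]+k]≡n {k} {m} {n} k≤m m≤n = begin
  (m ∸ k) ℕ.+ ((n ∸ m) ℕ.+ k)   ≡⟨ ≡.cong ((m ∸ k) ℕ.+_) (ℕ.+-comm (n ∸ m) k) ⟩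
  (m ∸ k) ℕ.+ (k ℕ.+ (n ∸ m))   ≡⟨ ℕ.+-assoc (m ∸ k) k (n ∸ m) ⟨
  (m ∸ k) ℕ.+ k ℕ.+ (n ∸ m)     ≡⟨ ≡.cong (ℕ._+ (n ∸ m)) (ℕ.m∸n+n≡m k≤m) ⟩
  m ℕ.+ (n ∸ m)                 ≡⟨ ℕ.m+[n∸m]≡n m≤n ⟩
  n                             ∎
  where open ≡.≡-Reasoning

module Interlacing {c ℓ₁ ℓ₂ ℓ₃} (F : OrderedField c ℓ₁ ℓ₂ ℓ₃) where
  open Field F
  open Eigenvalues F using (fromℤ; scalar; AreEigenvalues)
  open RawSemiringDefinitions (Semiring.rawSemiring semiring) using (product; _^_)
  private module E = Eigenvalues F

  -- Determinants

  infix 4 _≋_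
  _≋_ : ∀ {n} → (x y : Fin n → Carrier) → Set ℓ₁
  x ≋ y = ∀ i → x i ≈ y i

  -1^ : ∀ {n} → Fin n → Carrier
  -1^ j = (- 1#) ^ toℕ j

  minor : ∀ {n} → Matrix Carrier (suc n) → Fin (suc n) → Matrix Carrier n
  minor M j i l = M (suc i) (punchIn j l)

  -- Opaque for the same reason as `∑`; `det≈` gives the way back to the determinant of the
  -- statement.
  abstract
    det : ∀ {n} → Matrix Carrier n → Carrier
    det = E.det

    det≈ : ∀ {n} (M : Matrix Carrier n) → det M ≈ E.det M
    det≈ M = refl

    det-empty : {M : Matrix Carrier 0} → det M ≈ 1#
    det-empty = refl

    det-expand : ∀ {n} {M : Matrix Carrier (suc n)} → det M ≈ ∑ λ j → -1^ j * (M zero j * det (minor M j))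
    det-expand = sym (∑≈sum _)

  det-cong : ∀ {n} {M N : Matrix Carrier n} → (∀ i → M i ≋ N i) → det M ≈ det N
  det-cong {0}     e = trans det-empty (sym det-empty)
  det-cong {suc n} e = trans det-expand (trans (∑-cong λ j →
    *-congˡ (*-cong (e zero j) (det-cong λ i l → e (suc i) (punchIn j l)))) (sym det-expand))

  det-minors-zero : ∀ {n} (M : Matrix Carrier (suc n)) → (∀ j → det (minor M j) ≈ 0#) → det M ≈ 0#
  det-minors-zero M z = trans det-expand (∑-zero λ j →
    trans (*-congˡ (trans (*-congˡ (z j)) (zeroʳ _))) (zeroʳ _))

  -- The corner terms agree by induction. In every other term the minor is transposed and expanded
  -- once more, which gives a double sum over the minors without rows 0, i + 1 and columns 0, j + 1.
  -- Exchanging the two sums produces the expansion of the other side. Two indices are removed at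
  -- once, hence the separate case of size 1.
  det-transpose : ∀ {n} (M : Matrix Carrier n) → det (flip M) ≈ det M
  det-transpose {0}           M = trans det-empty (sym det-empty)
  det-transpose {1}           M = trans det-expand (trans (∑-cong λ { zero → *-congˡ (*-congˡ (det-cong λ ())) ; (suc ()) }) (sym det-expand))
  det-transpose {suc (suc n)} M = trans det-expand (trans ∑-suc (trans (+-cong
    (*-congˡ (*-congˡ (det-transpose (minor M zero))))
    (begin
      ∑ (λ i → -1^ (suc i) * (M (suc i) zero * det (minor (flip M) (suc i))))
        ≈⟨ ∑-cong (λ i → *-congˡ (*-congˡ (trans (sym (det-transpose (minor (flip M) (suc i)))) det-expand))) ⟩
      ∑ (λ i → -1^ (suc i) * (M (suc i) zero * ∑ (λ j → -1^ j * (M zero (suc j) * A i j))))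
        ≈⟨ ∑-cong (λ i → trans (*-congˡ (*-∑ _)) (*-∑ _)) ⟩
      ∑ (λ i → ∑ (λ j → -1^ (suc i) * (M (suc i) zero * (-1^ j * (M zero (suc j) * A i j)))))
        ≈⟨ ∑-swap ⟩
      ∑ (λ j → ∑ (λ i → -1^ (suc i) * (M (suc i) zero * (-1^ j * (M zero (suc j) * A i j)))))
        ≈⟨ ∑-cong (λ j → ∑-cong (λ i → trans
             (solve 6 (λ o s a t b d → o :* s :* (a :* (t :* (b :* d))) := o :* t :* (b :* (s :* (a :* d))))
                refl (- 1#) (-1^ i) (M (suc i) zero) (-1^ j) (M zero (suc j)) (A i j))
             (*-congˡ (*-congˡ (*-congˡ (*-congˡ (sym (det-transpose (A′ i j))))))))) ⟩
      ∑ (λ j → ∑ (λ i → -1^ (suc j) * (M zero (suc j) * (-1^ i * (M (suc i) zero * det (flip (A′ i j)))))))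
        ≈⟨ ∑-cong (λ j → trans (*-congˡ (*-∑ _)) (*-∑ _)) ⟨
      ∑ (λ j → -1^ (suc j) * (M zero (suc j) * ∑ (λ i → -1^ i * (M (suc i) zero * det (flip (A′ i j))))))
        ≈⟨ ∑-cong (λ j → *-congˡ {x = -1^ (suc j)} (*-congˡ (trans (sym det-expand) (det-transpose (minor M (suc j)))))) ⟩
      ∑ (λ j → -1^ (suc j) * (M zero (suc j) * det (minor M (suc j)))) ∎)) (trans (sym ∑-suc) (sym det-expand))))
    where
    A′ : Fin (suc n) → Fin (suc n) → Matrix Carrier n
    A′ i j a b = M (suc (punchIn i a)) (suc (punchIn j b))
    A : Fin (suc n) → Fin (suc n) → Carrier
    A i j = det (A′ i j)

  -- The matrices are related entrywise instead of being updates of a single one, so that their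
  -- minors satisfy the same hypotheses in the induction.
  det-linear : ∀ {n} (M A B : Matrix Carrier n) r x y →
    (∀ i → i ≢ r → M i ≋ A i) → (∀ i → i ≢ r → M i ≋ B i) →
    (∀ j → M r j ≈ x * A r j + y * B r j) → det M ≈ x * det A + y * det B
  det-linear {suc n} M A B r x y M≋A M≋B Mr = trans det-expand (trans (∑-cong (term r M≋A M≋B Mr))
    (trans (∑-linear x y) (sym (+-cong (*-congˡ det-expand) (*-congˡ det-expand)))))
    where
    T : Matrix Carrier (suc n) → Fin (suc n) → Carrier
    T N j = -1^ j * (N zero j * det (minor N j))
    term : ∀ r → (∀ i → i ≢ r → M i ≋ A i) → (∀ i → i ≢ r → M i ≋ B i) →
      (∀ j → M r j ≈ x * A r j + y * B r j) → ∀ j → T M j ≈ x * T A j + y * T B j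
    term zero M≋A M≋B Mr j = begin
      T M j
        ≈⟨ *-congˡ (*-congʳ (Mr j)) ⟩
      -1^ j * ((x * A zero j + y * B zero j) * det (minor M j))
        ≈⟨ solve 6 (λ s x a y b d → s :* ((x :* a :+ y :* b) :* d) := x :* (s :* (a :* d)) :+ y :* (s :* (b :* d)))
             refl (-1^ j) x (A zero j) y (B zero j) _ ⟩
      x * (-1^ j * (A zero j * det (minor M j))) + y * (-1^ j * (B zero j * det (minor M j)))
        ≈⟨ +-cong (*-congˡ (*-congˡ (*-congˡ (det-cong λ i l → M≋A (suc i) (λ ()) _))))
                  (*-congˡ (*-congˡ (*-congˡ (det-cong λ i l → M≋B (suc i) (λ ()) _)))) ⟩
      x * T A j + y * T B j ∎
    term (suc r) M≋A M≋B Mr j = begin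
      T M j
        ≈⟨ *-congˡ (*-congˡ (det-linear (minor M j) (minor A j) (minor B j) r x y
             (λ i i≢r l → M≋A (suc i) (i≢r ∘ suc-injective) _)
             (λ i i≢r l → M≋B (suc i) (i≢r ∘ suc-injective) _) (λ l → Mr _))) ⟩
      -1^ j * (M zero j * (x * det (minor A j) + y * det (minor B j)))
        ≈⟨ solve 6 (λ s m x a y b → s :* (m :* (x :* a :+ y :* b)) := x :* (s :* (m :* a)) :+ y :* (s :* (m :* b)))
             refl (-1^ j) (M zero j) x _ y _ ⟩
      x * (-1^ j * (M zero j * det (minor A j))) + y * (-1^ j * (M zero j * det (minor B j)))
        ≈⟨ +-cong (*-congˡ (*-congˡ (*-congʳ (M≋A zero (λ ()) j)))) (*-congˡ (*-congˡ (*-congʳ (M≋B zero (λ ()) j)))) ⟩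
      x * T A j + y * T B j ∎

  -- The first two terms of the expansion have equal minors and opposite signs; every other minor
  -- again has equal first two columns. Columns come before rows because the expansion runs along a
  -- row.
  det-equal-columns-01 : ∀ {n} (M : Matrix Carrier (suc (suc n))) →
    (∀ i → M i zero ≈ M i (suc zero)) → det M ≈ 0#
  det-equal-columns-01 M e = begin
    det M
      ≈⟨ trans det-expand (trans ∑-suc (+-congˡ ∑-suc)) ⟩
    -1^ {2} zero * (M zero zero * D₀) + (-1^ {2} (suc zero) * (M zero (suc zero) * D₁) + rest)
      ≈⟨ +-cong (*-congˡ (*-cong (e zero) (det-cong minors))) (+-congˡ (∑-zero (λ j → vanish j M e))) ⟩
    1# * (M zero (suc zero) * D₁) + (- 1# * 1# * (M zero (suc zero) * D₁) + 0#)
      ≈⟨ solve 2 (λ o m → o :* m :+ (:- o :* con 1ℤ :* m :+ con 0ℤ) := con 0ℤ) refl 1# _ ⟩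
    0# ∎
    where
    D₀ = det (minor M zero)
    D₁ = det (minor M (suc zero))
    rest = ∑ λ j → -1^ (suc (suc j)) * (M zero (suc (suc j)) * det (minor M (suc (suc j))))
    minors : ∀ i → minor M zero i ≋ minor M (suc zero) i
    minors i zero    = sym (e (suc i))
    minors i (suc l) = refl
    vanish : ∀ {n} (j : Fin n) (M : Matrix Carrier (suc (suc n))) → (∀ i → M i zero ≈ M i (suc zero)) →
      -1^ (suc (suc j)) * (M zero (suc (suc j)) * det (minor M (suc (suc j)))) ≈ 0#
    vanish {suc n} j M e = trans (*-congˡ (trans (*-congˡ
      (det-equal-columns-01 (minor M (suc (suc j))) (e ∘ suc))) (zeroʳ _))) (zeroʳ _)

  det-equal-rows-01 : ∀ {n} (M : Matrix Carrier (suc (suc n))) → M zero ≋ M (suc zero) → det M ≈ 0#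
  det-equal-rows-01 M e = trans (sym (det-transpose M)) (det-equal-columns-01 (flip M) e)

  -- Polarisation: with `u + w` in both rows the determinant vanishes, and bilinearity leaves
  -- exactly the two mixed terms.
  det-swap-01 : ∀ {n} (u w : Vector Carrier (suc (suc n))) (R : Fin n → Vector Carrier (suc (suc n))) →
    det (u Vector.∷ w Vector.∷ R) + det (w Vector.∷ u Vector.∷ R) ≈ 0#
  det-swap-01 u w R = begin
    D u w + D w u
      ≈⟨ +-cong (trans (+-congʳ (det-equal-rows-01 (u Vector.∷ u Vector.∷ R) (λ _ → refl))) (+-identityˡ _))
                (trans (+-congˡ (det-equal-rows-01 (w Vector.∷ w Vector.∷ R) (λ _ → refl))) (+-identityʳ _)) ⟨
    (D u u + D u w) + (D w u + D w w)
      ≈⟨ +-cong (linear₁ u) (linear₁ w) ⟨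
    D u v + D w v
      ≈⟨ linear₀ ⟨
    D v v
      ≈⟨ det-equal-rows-01 (v Vector.∷ v Vector.∷ R) (λ _ → refl) ⟩
    0# ∎
    where
    v = λ j → u j + w j
    D : Vector Carrier _ → Vector Carrier _ → Carrier
    D x y = det (x Vector.∷ y Vector.∷ R)
    one : ∀ {x y} → x + y ≈ 1# * x + 1# * y
    one = sym (+-cong (*-identityˡ _) (*-identityˡ _))
    linear₁ : ∀ x → D x v ≈ D x u + D x w
    linear₁ x = trans (det-linear (x Vector.∷ v Vector.∷ R) (x Vector.∷ u Vector.∷ R) (x Vector.∷ w Vector.∷ R)
      (suc zero) 1# 1# off off (λ j → one)) (sym one)
      where
      off : ∀ {y} i → i ≢ suc zero → (x Vector.∷ v Vector.∷ R) i ≋ (x Vector.∷ y Vector.∷ R) i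
      off zero          _ _ = refl
      off (suc zero)    p _ = contradiction ≡.refl p
      off (suc (suc i)) _ _ = refl
    linear₀ : D v v ≈ D u v + D w v
    linear₀ = trans (det-linear (v Vector.∷ v Vector.∷ R) (u Vector.∷ v Vector.∷ R) (w Vector.∷ v Vector.∷ R)
      zero 1# 1# off off (λ j → one)) (sym one)
      where
      off : ∀ {y} i → i ≢ zero → (v Vector.∷ v Vector.∷ R) i ≋ (y Vector.∷ v Vector.∷ R) i
      off zero    p _ = contradiction ≡.refl p
      off (suc i) _ _ = refl

  -- Equal rows below the top survive in every minor of the first-row expansion. If the top row is
  -- one of them and the other is not its neighbour, exchanging the first two rows moves both below
  -- the top.
  det-equal-rows : ∀ {n} (M : Matrix Carrier n) {r s} → r ≢ s → M r ≋ M s → det M ≈ 0#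
  det-equal-rows {suc n} M {r} {s} r≢s e = go r s r≢s e
    where
    go₀ : ∀ {n} (M : Matrix Carrier (suc n)) s → M zero ≋ M (suc s) →
      (∀ (N : Matrix Carrier n) {r s} → r ≢ s → N r ≋ N s → det N ≈ 0#) → det M ≈ 0#
    go₀ M zero    e IH = det-equal-rows-01 M e
    go₀ M (suc s) e IH = begin
      det M
        ≈⟨ det-cong (λ { zero _ → refl ; (suc zero) _ → refl ; (suc (suc i)) _ → refl }) ⟩
      det (M zero Vector.∷ M (suc zero) Vector.∷ R)
        ≈⟨ +-identityʳ _ ⟨
      det (M zero Vector.∷ M (suc zero) Vector.∷ R) + 0#
        ≈⟨ +-congˡ (det-minors-zero (M (suc zero) Vector.∷ M zero Vector.∷ R)
             (λ j → IH _ {zero} {suc s} (λ ()) (λ l → e (punchIn j l)))) ⟨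
      det (M zero Vector.∷ M (suc zero) Vector.∷ R) + det (M (suc zero) Vector.∷ M zero Vector.∷ R)
        ≈⟨ det-swap-01 (M zero) (M (suc zero)) R ⟩
      0# ∎
      where R = λ i → M (suc (suc i))
    go : ∀ r s → r ≢ s → M r ≋ M s → det M ≈ 0#
    go zero    zero    r≢s e = contradiction ≡.refl r≢s
    go zero    (suc s) r≢s e = go₀ M s e det-equal-rows
    go (suc r) zero    r≢s e = go₀ M r (sym ∘ e) det-equal-rows
    go (suc r) (suc s) r≢s e = det-minors-zero M λ j →
      det-equal-rows (minor M j) (r≢s ∘ ≡.cong suc) (λ l → e _)

  -- Row operations on determinants

  ≡⇒≋ : ∀ {n} {u v : Vector Carrier n} → u ≡ v → u ≋ v
  ≡⇒≋ ≡.refl i = refl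

  module _ {m n} (M : Fin m → Vector Carrier n) (p : Fin m) (v : Vector Carrier n) where
    replaced-at : updateAt M p (const v) p ≋ v
    replaced-at = ≡⇒≋ (updateAt-updates p M)

    replaced-off : ∀ i → i ≢ p → updateAt M p (const v) i ≋ M i
    replaced-off i i≢p = ≡⇒≋ (updateAt-minimal i p M i≢p)

  det-row-operation : ∀ {n} (M N : Matrix Carrier n) {p q} x y → p ≢ q →
    (∀ i → i ≢ p → N i ≋ M i) → (∀ j → N p j ≈ x * M p j + y * M q j) → det N ≈ x * det M
  det-row-operation M N {p} {q} x y p≢q off Np = begin
    det N                ≈⟨ det-linear N M B p x y off (λ i i≢p j → trans (off i i≢p j) (sym (replaced-off M p (M q) i i≢p j)))
                              (λ j → trans (Np j) (+-congˡ (*-congˡ (sym (replaced-at M p (M q) j))))) ⟩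
    x * det M + y * det B ≈⟨ +-congˡ (*-congˡ (det-equal-rows B p≢q (λ j → trans (replaced-at M p (M q) j)
                               (sym (replaced-off M p (M q) q (p≢q ∘ ≡.sym) j))))) ⟩
    x * det M + y * 0#   ≈⟨ trans (+-congˡ (zeroʳ y)) (+-identityʳ _) ⟩
    x * det M            ∎
    where
    B = updateAt M p (const (M q))

  -- The rows of `N` are reset to those of `M` one by one; the list in `go` contains all rows that
  -- may still differ.
  det-eliminate : ∀ {n} (M N : Matrix Carrier n) p → N p ≋ M p →
    (∀ i → ∃[ a ] (∀ j → N i j ≈ M i j + a * M p j)) → det N ≈ det M
  det-eliminate {n} M N p Np = go (allFin n) N Np (λ i i∉ → contradiction (∈-allFin i) i∉)
    where
    go : ∀ (qs : List (Fin n)) N → N p ≋ M p → (∀ i → i ∉ qs → N i ≋ M i) →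
      (∀ i → ∃[ a ] (∀ j → N i j ≈ M i j + a * M p j)) → det N ≈ det M
    go [] N Np off op = det-cong (λ i → off i (λ ()))
    go (q ∷ qs) N Np off op = trans N≈N′ (go qs N′ N′p off′ op′)
      where
      N′ = updateAt N q (const (M q))
      N′q = replaced-at N q (M q)
      N′off = replaced-off N q (M q)
      N′p : N′ p ≋ M p
      N′p with p ≟ q
      ... | yes ≡.refl = N′q
      ... | no  p≢q    = λ j → trans (N′off p p≢q j) (Np j)
      off′ : ∀ i → i ∉ qs → N′ i ≋ M i
      off′ i i∉ with i ≟ q
      ... | yes ≡.refl = N′q
      ... | no  i≢q    = λ j → trans (N′off i i≢q j) (off i (λ { (here e) → i≢q e ; (there m) → i∉ m }) j)
      op′ : ∀ i → ∃[ a ] (∀ j → N′ i j ≈ M i j + a * M p j)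
      op′ i with i ≟ q
      ... | yes ≡.refl = 0# , λ j → trans (N′q j) (sym (trans (+-congˡ (zeroˡ _)) (+-identityʳ _)))
      ... | no  i≢q    = proj₁ (op i) , λ j → trans (N′off i i≢q j) (proj₂ (op i) j)
      N≈N′ : det N ≈ det N′
      N≈N′ with p ≟ q
      ... | yes ≡.refl = det-cong same
        where
        same : ∀ i → N i ≋ N′ i
        same i j with i ≟ p
        ... | yes ≡.refl = trans (Np j) (sym (N′q j))
        ... | no  i≢p    = sym (N′off i i≢p j)
      ... | no  p≢q = trans (det-row-operation N′ N 1# (proj₁ (op q)) (p≢q ∘ ≡.sym)
                         (λ i i≢q j → sym (N′off i i≢q j))
                         (λ j → trans (proj₂ (op q) j) (+-cong (trans (sym (N′q j)) (sym (*-identityˡ _)))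
                                  (*-congˡ (sym (N′p j))))))
                       (*-identityˡ _)

  combination : ∀ {k n} → Vector Carrier k → (Fin k → Vector Carrier n) → Vector Carrier n
  combination x b j = ∑ λ i → x i * b i j

  -- By multilinearity in row `p`, every summand except the one with row `p` itself has a repeated
  -- row.
  det-row-combination : ∀ {n} (M N : Matrix Carrier n) {p} x →
    (∀ i → i ≢ p → N i ≋ M i) → N p ≋ combination x M → det N ≈ x p * det M
  det-row-combination {n} M N {p} x off Np = begin
    det N                                   ≈⟨ det-cong same ⟩
    det (M[ combination x M ])              ≈⟨ expand x M ⟩
    ∑ (λ i → x i * det (M[ M i ]))        ≈⟨ ∑-single p (λ i i≢p → trans (*-congˡ (det-equal-rows M[ M i ] (i≢p ∘ ≡.sym)
                                                 (λ j → trans (replaced-at M p (M i) j) (sym (replaced-off M p (M i) i i≢p j))))) (zeroʳ _)) ⟩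
    x p * det (M[ M p ])                    ≈⟨ *-congˡ (det-cong unchanged) ⟩
    x p * det M                             ∎
    where
    M[_] : Vector Carrier n → Matrix Carrier n
    M[ v ] = updateAt M p (const v)
    same : ∀ i → N i ≋ M[ combination x M ] i
    same i j with i ≟ p
    ... | yes ≡.refl = trans (Np j) (sym (replaced-at M p _ j))
    ... | no  i≢p    = trans (off i i≢p j) (sym (replaced-off M p _ i i≢p j))
    unchanged : ∀ i → M[ M p ] i ≋ M i
    unchanged i j with i ≟ p
    ... | yes ≡.refl = replaced-at M p _ j
    ... | no  i≢p    = replaced-off M p _ i i≢p j
    -- The combined family `R` is separated from `M`, since the induction shortens it while the
    -- other rows of `M` stay fixed.
    expand : ∀ {k} (x : Vector Carrier k) (R : Fin k → Vector Carrier n) →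
      det M[ combination x R ] ≈ ∑ (λ i → x i * det M[ R i ])
    expand {0} x R = trans (det-linear M[ combination x R ] M M p 0# 0#
        (replaced-off M p _) (replaced-off M p _)
        (λ j → trans (replaced-at M p _ j) (trans ∑-empty (sym (trans (+-cong (zeroˡ _) (zeroˡ _)) (+-identityˡ 0#))))))
      (trans (trans (+-cong (zeroˡ _) (zeroˡ _)) (+-identityˡ 0#)) (sym ∑-empty))
    expand {suc k} x R = begin
      det M[ combination x R ]
        ≈⟨ det-linear M[ combination x R ] M[ R zero ] M[ combination (x ∘ suc) (R ∘ suc) ] p (x zero) 1#
             (λ i i≢p j → trans (replaced-off M p _ i i≢p j) (sym (replaced-off M p _ i i≢p j)))
             (λ i i≢p j → trans (replaced-off M p _ i i≢p j) (sym (replaced-off M p _ i i≢p j)))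
             (λ j → trans (replaced-at M p _ j) (trans ∑-suc (+-cong (*-congˡ (sym (replaced-at M p _ j)))
                (trans (sym (replaced-at M p _ j)) (sym (*-identityˡ _)))))) ⟩
      x zero * det M[ R zero ] + 1# * det M[ combination (x ∘ suc) (R ∘ suc) ]
        ≈⟨ +-congˡ (trans (*-identityˡ _) (expand (x ∘ suc) (R ∘ suc))) ⟩
      x zero * det M[ R zero ] + ∑ (λ i → x (suc i) * det M[ R (suc i) ])
        ≈⟨ ∑-suc ⟨
      ∑ (λ i → x i * det M[ R i ]) ∎

  -- Linear dependence

  Nonzero : ∀ {n} → Vector Carrier n → Set ℓ₂
  Nonzero x = ∃[ i ] x i # 0#

  0ᵛ : ∀ {n} → Vector Carrier n
  0ᵛ _ = 0#

  Dependent : ∀ {k n} → (Fin k → Vector Carrier n) → Set (c ⊔ ℓ₁ ⊔ ℓ₂)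
  Dependent b = ∃[ x ] Nonzero x × combination x b ≋ 0ᵛ

  -1^-#0 : ∀ {n} (j : Fin n) → -1^ j # 0#
  -1^-#0 zero    = 1#0
  -1^-#0 (suc j) = x#0y#0→xy#0
    (inverse-#0 (trans (-1*x≈-x (- 1#)) (-‿involutive 1#))) (-1^-#0 j)

  det-expand-column : ∀ {n} (M : Matrix Carrier (suc n)) →
    det M ≈ ∑ λ i → -1^ i * (M i zero * det (λ a l → M (punchIn i a) (suc l)))
  det-expand-column M = trans (sym (det-transpose M)) (trans det-expand
    (∑-cong λ i → *-congˡ (*-congˡ (sym (det-transpose (minor (flip M) i))))))

  module _ {k n} (M : Fin (suc k) → Vector Carrier n) (p : Fin (suc k)) (y : Vector Carrier k) where
    eliminated : Fin k → Vector Carrier n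
    eliminated i j = M (punchIn p i) j - y i * M p j

    -- The multiples of row `p` that were subtracted add up to `s` in the given relation; the
    -- coefficient `- s` at `p` compensates for them.
    Dependent-eliminated : Dependent eliminated → Dependent M
    Dependent-eliminated (x , (i , xi#0) , e) = x′ , (punchIn p i , #-congʳ (sym (x′-punchIn i)) xi#0) , λ j → begin
      ∑ (λ i → x′ i * M i j)
        ≈⟨ ∑-remove p ⟩
      x′ p * M p j + ∑ (λ i → x′ (punchIn p i) * M (punchIn p i) j)
        ≈⟨ +-cong (*-congʳ x′-p) (∑-cong λ i → trans (*-congʳ (x′-punchIn i))
             (solve 4 (λ x m y q → x :* m := con 1ℤ :* (x :* (m :- y :* q)) :+ q :* (x :* y))
                     refl (x i) (M (punchIn p i) j) (y i) (M p j))) ⟩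
      - s * M p j + ∑ (λ i → 1# * (x i * eliminated i j) + M p j * (x i * y i))
        ≈⟨ +-congˡ (∑-linear 1# (M p j)) ⟩
      - s * M p j + (1# * combination x eliminated j + M p j * s)
        ≈⟨ +-congˡ (+-congʳ (*-congˡ (e j))) ⟩
      - s * M p j + (1# * 0# + M p j * s)
        ≈⟨ solve 3 (λ s m o → :- s :* m :+ (o :* con 0ℤ :+ m :* s) := con 0ℤ) refl s (M p j) 1# ⟩
      0# ∎
      where
      s = ∑ λ i → x i * y i
      x′ = insertAt x p (- s)
      x′-p : x′ p ≈ - s
      x′-p = reflexive (insertAt-lookup x p (- s))
      x′-punchIn : ∀ i → x′ (punchIn p i) ≈ x i
      x′-punchIn i = reflexive (insertAt-punchIn x p (- s) i)

  module _ {k n} (M : Fin k → Vector Carrier (suc n)) where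
    tails : Fin k → Vector Carrier n
    tails i = M i ∘ suc

    Dependent-tails : (∀ i → M i zero ≈ 0#) → Dependent tails → Dependent M
    Dependent-tails z (x , x#0 , e) = x , x#0 , λ where
      zero    → ∑-zero λ i → trans (*-congˡ (z i)) (zeroʳ _)
      (suc j) → e j

  Dependent-suc : ∀ {k n} (M : Fin (suc k) → Vector Carrier n) → Dependent (M ∘ suc) → Dependent M
  Dependent-suc M (x , (i , xi#0) , e) = (0# Vector.∷ x) , (suc i , xi#0) , λ j →
    trans ∑-suc (trans (+-cong (zeroˡ _) (e j)) (+-identityˡ 0#))

  module _ {k n} (M : Fin (suc k) → Vector Carrier (suc n)) {p} {z} (inv : M p zero * z ≈ 1#) where
    multiplier : Vector Carrier (suc k)
    multiplier i = M i zero * z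

    column-cleared : ∀ i → M i zero - multiplier i * M p zero ≈ 0#
    column-cleared i = begin
      M i zero - M i zero * z * M p zero
        ≈⟨ solve 3 (λ m z q → m :- m :* z :* q := m :- m :* (q :* z)) refl (M i zero) z (M p zero) ⟩
      M i zero - M i zero * (M p zero * z)
        ≈⟨ +-congˡ (-‿cong (trans (*-congˡ inv) (*-identityʳ _))) ⟩
      M i zero - M i zero
        ≈⟨ -‿inverseʳ _ ⟩
      0# ∎

    cleared : Fin k → Vector Carrier (suc n)
    cleared = eliminated M p (multiplier ∘ punchIn p)

    Dependent-cleared : Dependent (tails cleared) → Dependent M
    Dependent-cleared d = Dependent-eliminated M p (multiplier ∘ punchIn p)
      (Dependent-tails cleared (column-cleared ∘ punchIn p) d)

  -- Gaussian elimination on the first column. With or without a pivot, one vector and one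
  -- coordinate disappear, so the surplus of one vector persists.
  dependent : ∀ n (M : Fin (suc n) → Vector Carrier n) → ¬ ¬ Dependent M
  dependent 0       M k = k ((λ _ → 1#) , (zero , 1#0) , λ ())
  dependent (suc n) M k = vector-#0-or-≈0 (λ i → M i zero) λ where
    (inj₂ z) → dependent n (tails (M ∘ suc)) (k ∘ Dependent-suc M ∘ Dependent-tails (M ∘ suc) (z ∘ suc))
    (inj₁ (p , a)) → let _ , inv = inverse a in
      dependent n (tails (cleared M inv)) (k ∘ Dependent-cleared M inv)

  -- If the first column vanishes, the tails are n + 1 vectors with n coordinates. Otherwise
  -- clearing the column leaves the determinant equal to a sign times the pivot times a smaller
  -- determinant, which must then be zero.
  det≈0⇒dependent : ∀ {n} (M : Matrix Carrier n) → det M ≈ 0# → ¬ ¬ Dependent M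
  det≈0⇒dependent {0}     M z k = proj₂ (tight _ _) (trans (sym det-empty) z) 1#0
  det≈0⇒dependent {suc n} M z k = vector-#0-or-≈0 (λ i → M i zero) λ where
      (inj₂ z) → dependent n (tails M) (k ∘ Dependent-tails M z)
      (inj₁ (p , a)) → pivot p a (inverse a)
    where
    pivot : ∀ p → M p zero # 0# → ∃[ w ] M p zero * w ≈ 1# → ⊥
    pivot p a (w , inv) = det≈0⇒dependent (tails (cleared M inv))
      (*-cancel-#0 (x#0y#0→xy#0 (-1^-#0 p) a) (begin
        -1^ p * M p zero * det (tails (cleared M inv))
          ≈⟨ *-assoc _ _ _ ⟩
        -1^ p * (M p zero * det (tails (cleared M inv)))
          ≈⟨ *-congˡ (*-cong (sym (Np zero)) (det-cong λ i j → sym (off (punchIn p i) (punchInᵢ≢i p i) (suc j)))) ⟩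
        -1^ p * (N p zero * det (λ i j → N (punchIn p i) (suc j)))
          ≈⟨ ∑-single p (λ i i≢p → trans (*-congˡ (trans (*-congʳ (trans (off i i≢p zero) (column-cleared M inv i))) (zeroˡ _))) (zeroʳ _)) ⟨
        ∑ (λ i → -1^ i * (N i zero * det (λ a l → N (punchIn i a) (suc l))))
          ≈⟨ det-expand-column N ⟨
        det N
          ≈⟨ det-eliminate M N p Np op ⟩
        det M
          ≈⟨ z ⟩
        0# ∎))
      (k ∘ Dependent-cleared M inv)
      where
      m = multiplier M inv
      N : Matrix Carrier (suc n)
      -- Unlike `cleared`, `N` keeps the pivot row, so it is square and has the determinant of `M`.
      N = updateAt (λ i j → M i j - m i * M p j) p (const (M p))
      Np : N p ≋ M p
      Np = replaced-at (λ i j → M i j - m i * M p j) p (M p)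
      off : ∀ i → i ≢ p → N i ≋ (λ j → M i j - m i * M p j)
      off = replaced-off (λ i j → M i j - m i * M p j) p (M p)
      op : ∀ i → ∃[ a ] (∀ j → N i j ≈ M i j + a * M p j)
      op i with i ≟ p
      ... | yes ≡.refl = 0# , λ j → trans (Np j) (sym (trans (+-congˡ (zeroˡ _)) (+-identityʳ _)))
      ... | no  i≢p    = - m i , λ j → trans (off i i≢p j) (+-congˡ (-‿distribˡ-* _ _))

  -- Polynomial functions

  -- Degree at most d, expressed by difference quotients instead of coefficients.
  HasDegree : ℕ → (Carrier → Carrier) → Set (c ⊔ ℓ₁)
  HasDegree 0       f = ∀ s t → f s ≈ f t
  HasDegree (suc d) f = ∀ r → ∃[ g ] HasDegree d g × (∀ t → f t ≈ f r + (t - r) * g t)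

  degree-cong : ∀ d {f g} → (∀ t → f t ≈ g t) → HasDegree d f → HasDegree d g
  degree-cong 0       e p s t = trans (sym (e s)) (trans (p s t) (e t))
  degree-cong (suc d) e p r = let h , q , eq = p r in
    h , q , λ t → trans (sym (e t)) (trans (eq t) (+-congʳ (e r)))

  degree-const : ∀ d a → HasDegree d (λ _ → a)
  degree-const 0       a s t = refl
  degree-const (suc d) a r = (λ _ → 0#) , degree-const d 0# , λ t → sym (trans (+-congˡ (zeroʳ _)) (+-identityʳ a))

  degree-suc : ∀ d {f} → HasDegree d f → HasDegree (suc d) f
  degree-suc 0       p r = (λ _ → 0#) , degree-const 0 0# , λ t →
    trans (p t r) (sym (trans (+-congˡ (zeroʳ _)) (+-identityʳ _)))
  degree-suc (suc d) p r = let h , q , eq = p r in h , degree-suc d q , eq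

  degree-raise : ∀ k {d f} → HasDegree d f → HasDegree (k ℕ.+ d) f
  degree-raise 0       p = p
  degree-raise (suc k) p = degree-suc _ (degree-raise k p)

  degree-+ : ∀ d {f g} → HasDegree d f → HasDegree d g → HasDegree d (λ t → f t + g t)
  degree-+ 0       p q s t = +-cong (p s t) (q s t)
  degree-+ (suc d) {f} {g} p q r = let f′ , p′ , ef = p r ; g′ , q′ , eg = q r in
    (λ t → f′ t + g′ t) , degree-+ d p′ q′ , λ t → trans (+-cong (ef t) (eg t))
      (solve 5 (λ a b s x y → a :+ s :* x :+ (b :+ s :* y) := a :+ b :+ s :* (x :+ y))
              refl (f r) (g r) (t - r) (f′ t) (g′ t))

  degree-scale : ∀ d a {f} → HasDegree d f → HasDegree d (λ t → a * f t)
  degree-scale 0       a p s t = *-congˡ (p s t)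
  degree-scale (suc d) a {f} p r = let f′ , p′ , ef = p r in
    (λ t → a * f′ t) , degree-scale d a p′ , λ t → trans (*-congˡ (ef t))
      (solve 4 (λ a b s x → a :* (b :+ s :* x) := a :* b :+ s :* (a :* x)) refl a (f r) (t - r) (f′ t))

  -- Leibniz rule for difference quotients at `r`: the quotient of the product is
  -- `f′ t * g t + f r * g′ t`, with one factor frozen at `r`.
  degree-* : ∀ d e {f g} → HasDegree d f → HasDegree e g → HasDegree (d ℕ.+ e) (λ t → f t * g t)
  degree-* 0 e {f} p q = degree-cong e (λ t → *-congʳ (p 0# t)) (degree-scale e (f 0#) q)
  degree-* (suc d) 0 {f} {g} p q r = let f′ , p′ , ef = p r in
    (λ t → f′ t * g t) , degree-* d 0 p′ q , λ t → trans (*-congʳ (ef t))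
      (trans (solve 4 (λ a b s x → (a :+ s :* x) :* b := a :* b :+ s :* (x :* b))
              refl (f r) (g t) (t - r) (f′ t))
        (+-congʳ (*-congˡ (q t r))))
  degree-* (suc d) (suc e) {f} {g} p q r = let f′ , p′ , ef = p r ; g′ , q′ , eg = q r in
    (λ t → f′ t * g t + f r * g′ t) ,
    degree-+ (d ℕ.+ suc e) (degree-* d (suc e) p′ q)
      (≡.subst (λ k → HasDegree k (λ t → f r * g′ t)) (≡.sym (ℕ.+-suc d e)) (degree-raise (suc d) (degree-scale e (f r) q′))) ,
    λ t → begin
      f t * g t
        ≈⟨ *-congʳ (ef t) ⟩
      (f r + (t - r) * f′ t) * g t
        ≈⟨ solve 4 (λ a b s x → (a :+ s :* x) :* b := a :* b :+ s :* (x :* b))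
                refl (f r) (g t) (t - r) (f′ t) ⟩
      f r * g t + (t - r) * (f′ t * g t)
        ≈⟨ +-congʳ (*-congˡ (eg t)) ⟩
      f r * (g r + (t - r) * g′ t) + (t - r) * (f′ t * g t)
        ≈⟨ solve 5 (λ a b s y z → a :* (b :+ s :* y) :+ s :* z := a :* b :+ s :* (z :+ a :* y))
                refl (f r) (g r) (t - r) (g′ t) (f′ t * g t) ⟩
      f r * g r + (t - r) * (f′ t * g t + f r * g′ t) ∎

  -- The point `r = T + 1#` is a root, and the quotient by `t - r` vanishes for all `t` beyond `r`,
  -- where `t - r` is invertible. Each division lowers the degree and shortens the ray.
  degree-vanishing : ∀ d {f} → HasDegree d f → ∀ T → (∀ t → T < t → f t ≈ 0#) → ∀ t → f t ≈ 0#
  degree-vanishing 0 p T z t = trans (p t (T + 1#)) (z (T + 1#) (<-resp-≈ (+-identityʳ T) refl (+-monoʳ-< T 0<1)))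
  degree-vanishing (suc d) {f} p T z t =
    let g , q , eq = p r
        g≈0 = degree-vanishing d q r λ t r<t → *-cancel-#0 (#-sym (<⇒# (sub-pos r<t)))
          (trans (sym (trans (eq t) (trans (+-congʳ fr≈0) (+-identityˡ _)))) (z t (SPO.trans T<r r<t)))
    in trans (eq t) (trans (+-cong fr≈0 (trans (*-congˡ (g≈0 t)) (zeroʳ _))) (+-identityˡ 0#))
    where
    r = T + 1#
    T<r : T < r
    T<r = <-resp-≈ (+-identityʳ T) refl (+-monoʳ-< T 0<1)
    fr≈0 : f r ≈ 0#
    fr≈0 = z r T<r

  IsPolynomial : (Carrier → Carrier) → Set (c ⊔ ℓ₁)
  IsPolynomial f = ∃[ d ] HasDegree d f

  polynomial-cong : ∀ {f g} → (∀ t → f t ≈ g t) → IsPolynomial f → IsPolynomial g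
  polynomial-cong e (d , p) = d , degree-cong d e p

  polynomial-const : ∀ a → IsPolynomial (λ _ → a)
  polynomial-const a = 0 , degree-const 0 a

  polynomial-id : IsPolynomial (λ t → t)
  polynomial-id = 1 , λ r → (λ _ → 1#) , degree-const 0 1# , λ t →
    solve 2 (λ t r → t := r :+ (t :- r) :* con 1ℤ) refl t r

  polynomial-+ : ∀ {f g} → IsPolynomial f → IsPolynomial g → IsPolynomial (λ t → f t + g t)
  polynomial-+ {f} {g} (d , p) (e , q) = e ℕ.+ d , degree-+ (e ℕ.+ d) (degree-raise e p)
    (≡.subst (λ k → HasDegree k g) (ℕ.+-comm d e) (degree-raise d q))

  polynomial-* : ∀ {f g} → IsPolynomial f → IsPolynomial g → IsPolynomial (λ t → f t * g t)
  polynomial-* (d , p) (e , q) = d ℕ.+ e , degree-* d e p q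

  polynomial-affine : ∀ a b → IsPolynomial (λ t → t * a - b)
  polynomial-affine a b = polynomial-+ (polynomial-* polynomial-id (polynomial-const a)) (polynomial-const (- b))

  polynomial-∑ : ∀ {n} {f : Fin n → Carrier → Carrier} → (∀ i → IsPolynomial (f i)) → IsPolynomial (λ t → ∑ λ i → f i t)
  polynomial-∑ {0}     p = polynomial-cong (λ t → sym ∑-empty) (polynomial-const 0#)
  polynomial-∑ {suc n} p = polynomial-cong (λ t → sym ∑-suc) (polynomial-+ (p zero) (polynomial-∑ (p ∘ suc)))

  polynomial-det : ∀ {n} {M : Carrier → Matrix Carrier n} → (∀ i j → IsPolynomial (λ t → M t i j)) → IsPolynomial (λ t → det (M t))
  polynomial-det {0}     p = polynomial-cong (λ t → sym det-empty) (polynomial-const 1#)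
  polynomial-det {suc n} {M} p = polynomial-cong (λ t → sym det-expand) (polynomial-∑ λ j →
    polynomial-* (polynomial-const (-1^ j)) (polynomial-* (p zero j) (polynomial-det λ i l → p (suc i) (punchIn j l))))

  monic : ∀ {n} → Vector Carrier n → Carrier → Carrier
  monic ev t = product λ i → t - ev i

  polynomial-monic : ∀ {n} (ev : Vector Carrier n) → IsPolynomial (monic ev)
  polynomial-monic {0}     ev = polynomial-const 1#
  polynomial-monic {suc n} ev = polynomial-* (polynomial-+ polynomial-id (polynomial-const _)) (polynomial-monic (ev ∘ suc))

  -- Cancellation is immediate beyond `r`; that ray determines the polynomial, so `t = r` is covered
  -- without deciding equality.
  cancel-linear : ∀ {f} → IsPolynomial f → ∀ r → (∀ t → (t - r) * f t ≈ 0#) → ∀ t → f t ≈ 0#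
  cancel-linear (d , p) r z = degree-vanishing d p r λ t r<t → *-cancel-#0 (#-sym (<⇒# (sub-pos r<t))) (z t)

  monic-nonzero : ∀ {n} (ev : Vector Carrier n) → ¬ (∀ t → monic ev t ≈ 0#)
  monic-nonzero {0}     ev z = proj₂ (tight _ _) (z 0#) 1#0
  monic-nonzero {suc n} ev z = monic-nonzero (ev ∘ suc) (cancel-linear (polynomial-monic (ev ∘ suc)) (ev zero) z)

  -- Symmetric bilinear forms

  record SymmetricForm (n : ℕ) : Set (c ⊔ ℓ₁) where
    field
      form        : Vector Carrier n → Vector Carrier n → Carrier
      form-congˡ  : ∀ {x y z} → x ≋ y → form x z ≈ form y z
      form-linear : ∀ a b {x y z} → form (λ i → a * x i + b * y i) z ≈ a * form x z + b * form y z
      form-sym    : ∀ {x y} → form x y ≈ form y x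

    form-congʳ : ∀ {x y z} → x ≋ y → form z x ≈ form z y
    form-congʳ e = trans form-sym (trans (form-congˡ e) form-sym)

    form-linearʳ : ∀ a b {x y z} → form z (λ i → a * x i + b * y i) ≈ a * form z x + b * form z y
    form-linearʳ a b = trans form-sym (trans (form-linear a b) (+-cong (*-congˡ form-sym) (*-congˡ form-sym)))

    form-0 : ∀ {x z} → x ≋ 0ᵛ → form x z ≈ 0#
    form-0 {x} {z} e = begin
      form x z                          ≈⟨ form-congˡ (λ i → trans (e i) (sym (trans (+-cong (zeroˡ (z i)) (zeroˡ (z i))) (+-identityˡ 0#)))) ⟩
      form (λ i → 0# * z i + 0# * z i) z ≈⟨ form-linear 0# 0# ⟩
      0# * form z z + 0# * form z z     ≈⟨ trans (+-cong (zeroˡ _) (zeroˡ _)) (+-identityˡ 0#) ⟩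
      0#                                ∎

    form-combination : ∀ {k} (x : Vector Carrier k) b {z} → form (combination x b) z ≈ ∑ λ i → x i * form (b i) z
    form-combination {0}     x b = trans (form-0 (λ _ → ∑-empty)) (sym ∑-empty)
    form-combination {suc k} x b {z} = begin
      form (combination x b) z
        ≈⟨ form-congˡ (λ j → trans ∑-suc (+-congˡ (sym (*-identityˡ _)))) ⟩
      form (λ j → x zero * b zero j + 1# * combination (x ∘ suc) (b ∘ suc) j) z
        ≈⟨ form-linear (x zero) 1# ⟩
      x zero * form (b zero) z + 1# * form (combination (x ∘ suc) (b ∘ suc)) z
        ≈⟨ +-congˡ (trans (*-identityˡ _) (form-combination (x ∘ suc) (b ∘ suc))) ⟩
      x zero * form (b zero) z + ∑ (λ i → x (suc i) * form (b (suc i)) z)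
        ≈⟨ ∑-suc ⟨
      ∑ (λ i → x i * form (b i) z) ∎

    form-combinationʳ : ∀ {k} (x : Vector Carrier k) b {z} → form z (combination x b) ≈ ∑ λ i → x i * form z (b i)
    form-combinationʳ x b = trans form-sym (trans (form-combination x b) (∑-cong λ i → *-congˡ form-sym))

    gram : ∀ {k} → (Fin k → Vector Carrier n) → (Fin k → Vector Carrier n) → Matrix Carrier k
    gram b e i j = form (b i) (e j)

    det-gram-sym : ∀ {k} (b e : Fin k → Vector Carrier n) → det (gram b e) ≈ det (gram e b)
    det-gram-sym b e = trans (sym (det-transpose (gram b e))) (det-cong λ i j → form-sym)

    -- The factor `a` arises once from the rows and once, through symmetry, from the columns.
    det-gram-change : ∀ {k} {b e : Fin k → Vector Carrier n} {a} →
      (∀ y → det (gram e y) ≈ a * det (gram b y)) → det (gram e e) ≈ a * a * det (gram b b)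
    det-gram-change {b = b} {e} {a} h = begin
      det (gram e e)            ≈⟨ h e ⟩
      a * det (gram b e)        ≈⟨ *-congˡ (trans (det-gram-sym b e) (h b)) ⟩
      a * (a * det (gram b b))  ≈⟨ *-assoc _ _ _ ⟨
      a * a * det (gram b b)    ∎

    det-gram-replace : ∀ {k} {b e : Fin k → Vector Carrier n} {p} x → (∀ i → i ≢ p → e i ≋ b i) →
      e p ≋ combination x b → det (gram e e) ≈ x p * x p * det (gram b b)
    det-gram-replace {b = b} {e} x off ep = det-gram-change λ y →
      det-row-combination (gram b y) (gram e y) x (λ i i≢p j → form-congˡ (off i i≢p))
        (λ j → trans (form-congˡ ep) (form-combination x b))

  open SymmetricForm

  pencil : ∀ {n} → SymmetricForm n → SymmetricForm n → Carrier → SymmetricForm n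
  pencil G S t = record
    { form        = λ x y → t * form G x y - form S x y
    ; form-congˡ  = λ e → +-cong (*-congˡ (form-congˡ G e)) (-‿cong (form-congˡ S e))
    ; form-linear = λ a b {x} {y} {z} → trans
        (+-cong (*-congˡ (form-linear G a b)) (-‿cong (form-linear S a b)))
        (solve 7 (λ t a b gx gy sx sy → t :* (a :* gx :+ b :* gy) :- (a :* sx :+ b :* sy)
                    := a :* (t :* gx :- sx) :+ b :* (t :* gy :- sy)) refl
          t a b (form G x z) (form G y z) (form S x z) (form S y z))
    ; form-sym    = +-cong (*-congˡ (form-sym G)) (-‿cong (form-sym S))
    }

  -- Orthogonal eigenvectors

  -- An exchange of v for a member of b, with v moved to index 0 so that it splits
  -- off in the first-row expansion of the Gram determinant.
  record Promoted {k n} (b : Fin (suc k) → Vector Carrier n) (v : Vector Carrier n) : Set (c ⊔ ℓ₁ ⊔ ℓ₂) where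
    field
      others   : Fin k → Vector Carrier n
      scale    : Carrier
      scale#0  : scale # 0#
      -- One `scale` serves all `Q`: the pencil varies with `t`, while the constant in front of the
      -- product of roots must not.
      det-gram≈ : ∀ Q → det (gram Q (v Vector.∷ others) (v Vector.∷ others)) ≈ scale * det (gram Q b b)
      spanned  : ∀ Q z → (∀ j → form Q z (b j) ≈ 0#) → ∀ j → form Q z (others j) ≈ 0#

  promote : ∀ {k n} (b : Fin (suc k) → Vector Carrier n) x → Nonzero x → ¬ ¬ Promoted b (combination x b)
  promote {k} {n} b x (p , xp#0) = λ k → #0-or-≈0 (x zero) λ where
      (inj₁ x₀#0) → k record
        { others    = b ∘ suc
        ; scale     = x zero * x zero
        ; scale#0   = x#0y#0→xy#0 x₀#0 x₀#0
        ; det-gram≈ = λ Q → det-gram-replace Q {e = combination x b Vector.∷ b ∘ suc} {zero} x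
            (λ { zero 0≢0 → contradiction ≡.refl 0≢0 ; (suc i) _ j → refl }) (λ j → refl)
        ; spanned   = λ Q z o → o ∘ suc
        }
      (inj₂ x₀≈0) → k (two-steps p xp#0 x₀≈0)
    where
    v = combination x b
    -- If x 0 vanishes, v cannot replace b 0 directly: first b p becomes w = b 0 + v,
    -- and then b 0 becomes w - b 0.
    two-steps : ∀ p → x p # 0# → x zero ≈ 0# → Promoted b v
    two-steps zero    x₀#0 x₀≈0 = contradiction x₀#0 (proj₂ (tight _ _) x₀≈0)
    two-steps (suc p) xp#0 x₀≈0 = record
      { others    = e ∘ suc
      ; scale     = - 1# * - 1# * (x (suc p) * x (suc p))
      ; scale#0   = x#0y#0→xy#0 (x#0y#0→xy#0 -1#0 -1#0) (x#0y#0→xy#0 xp#0 xp#0)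
      ; det-gram≈ = λ Q → begin
          det (gram Q f f)
            ≈⟨ det-gram-change Q {b = e} {f} {a = - 1#} (λ y → det-row-operation (gram Q e y) (gram Q f y) {q = suc p} (- 1#) 1# (λ ())
                 (λ { zero 0≢0 → contradiction ≡.refl 0≢0 ; (suc i) _ j → refl })
                 (λ j → trans (form-congˡ Q f₀) (form-linear Q (- 1#) 1#))) ⟩
          - 1# * - 1# * det (gram Q e e)
            ≈⟨ *-congˡ (det-gram-replace Q {e = e} {suc p} (1# Vector.∷ x ∘ suc) (replaced-off b (suc p) w) e-at) ⟩
          - 1# * - 1# * (x (suc p) * x (suc p) * det (gram Q b b))
            ≈⟨ *-assoc _ _ _ ⟨
          - 1# * - 1# * (x (suc p) * x (suc p)) * det (gram Q b b) ∎
      ; spanned   = λ Q z o j → e-spanned Q z o (suc j)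
      }
      where
      w : Vector Carrier n
      w j = 1# * b zero j + 1# * v j
      e = updateAt b (suc p) (const w)
      f = v Vector.∷ e ∘ suc
      -1#0 : - 1# # 0#
      -1#0 = #-congʳ (*-identityʳ _) (-1^-#0 {2} (suc zero))
      -- As `x zero` vanishes, `w` has coefficient 1 at `b zero` and still `x (suc p)` at
      -- `b (suc p)`.
      e-at : e (suc p) ≋ combination (1# Vector.∷ x ∘ suc) b
      e-at j = begin
        e (suc p) j
          ≈⟨ replaced-at b (suc p) w j ⟩
        1# * b zero j + 1# * v j
          ≈⟨ +-congˡ (trans (*-identityˡ _) (trans ∑-suc (trans (+-congʳ (trans (*-congʳ x₀≈0) (zeroˡ _))) (+-identityˡ _)))) ⟩
        1# * b zero j + ∑ (λ i → x (suc i) * b (suc i) j)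
          ≈⟨ ∑-suc ⟨
        combination (1# Vector.∷ x ∘ suc) b j ∎
      f₀ : v ≋ λ j → - 1# * e zero j + 1# * e (suc p) j
      f₀ j = begin
        v j ≈⟨ solve 2 (λ v b → v := :- (con 1ℤ) :* b :+ con 1ℤ :* (con 1ℤ :* b :+ con 1ℤ :* v))
                refl (v j) (b zero j) ⟩
        - 1# * b zero j + 1# * w j ≈⟨ +-congˡ (*-congˡ (replaced-at b (suc p) w j)) ⟨
        - 1# * e zero j + 1# * e (suc p) j ∎
      e-spanned : ∀ Q z → (∀ j → form Q z (b j) ≈ 0#) → ∀ j → form Q z (e j) ≈ 0#
      e-spanned Q z o j with j ≟ suc p
      ... | no  j≢p    = trans (form-congʳ Q (replaced-off b (suc p) w j j≢p)) (o j)
      ... | yes ≡.refl = begin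
        form Q z (e (suc p))                      ≈⟨ form-congʳ Q (replaced-at b (suc p) w) ⟩
        form Q z w                                ≈⟨ form-linearʳ Q 1# 1# ⟩
        1# * form Q z (b zero) + 1# * form Q z v  ≈⟨ +-cong (trans (*-identityˡ _) (o zero)) (trans (*-identityˡ _)
                                                       (trans (form-combinationʳ Q x b) (∑-zero λ i → trans (*-congˡ (o i)) (zeroʳ _)))) ⟩
        0# + 0#                                   ≈⟨ +-identityˡ 0# ⟩
        0#                                        ∎

  det-zero-row : ∀ {n} (M : Matrix Carrier n) p → M p ≋ 0ᵛ → det M ≈ 0#
  det-zero-row M p z = trans
    (det-linear M M M p 0# 0# (λ i _ j → refl) (λ i _ j → refl) (λ j → trans (z j) (sym 0·)))
    0·
    where
    0· : ∀ {x y} → 0# * x + 0# * y ≈ 0#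
    0· = trans (+-cong (zeroˡ _) (zeroˡ _)) (+-identityˡ 0#)

  module _ {n} (G S : SymmetricForm n) (G-positive : ∀ v → ¬ v ≋ 0ᵛ → ¬ ¬ (0# < form G v v)) where

    -- `spanned` expresses membership in the span of `b` by orthogonality to test vectors. This is
    -- the form in which it is used, and it spares carrying coefficients through the deflation.
    record Eigenbasis {k} (b : Fin k → Vector Carrier n) (ev : Vector Carrier k) : Set (c ⊔ ℓ₁ ⊔ ℓ₃) where
      field
        vectors      : Fin k → Vector Carrier n
        G-orthogonal : ∀ {i j} → i ≢ j → form G (vectors i) (vectors j) ≈ 0#
        S-orthogonal : ∀ {i j} → i ≢ j → form S (vectors i) (vectors j) ≈ 0#
        G-pos        : ∀ i → 0# < form G (vectors i) (vectors i)
        eigenvalue   : ∀ i → form S (vectors i) (vectors i) ≈ ev i * form G (vectors i) (vectors i)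
        spanned      : ∀ Q z → (∀ j → form Q z (b j) ≈ 0#) → ∀ i → form Q z (vectors i) ≈ 0#

    Splits : ∀ {k} → (Fin k → Vector Carrier n) → Carrier → Vector Carrier k → Set (c ⊔ ℓ₁)
    Splits b a ev = ∀ t → det (gram (pencil G S t) b b) ≈ a * monic ev t

    module Deflation {k} {b : Fin (suc k) → Vector Carrier n} {a ev} (a#0 : a # 0#) (splits : Splits b a ev) where
      λ₀ = ev zero

      singular : det (gram (pencil G S λ₀) b b) ≈ 0#
      singular = trans (splits λ₀) (trans (*-congˡ (trans (*-congʳ (-‿inverseʳ λ₀)) (zeroˡ _))) (zeroʳ a))

      -- Independence follows from the splitting: a relation among the `b i` would make the Gram
      -- determinant vanish for every `t`, against `monic-nonzero`.
      independent : ∀ x → Nonzero x → ¬ combination x b ≋ 0ᵛ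
      independent x (p , xp#0) v≋0 = monic-nonzero ev λ t → *-cancel-#0 a#0 (trans (sym (splits t)) (*-cancel-#0 xp#0 (begin
        x p * det (M t) ≈⟨ det-row-combination (M t) (N t) {p} x (replaced-off (M t) p (combination x (M t))) (replaced-at (M t) p (combination x (M t))) ⟨
        det (N t)       ≈⟨ det-zero-row (N t) p (λ j → trans (replaced-at (M t) p (combination x (M t)) j)
                             (trans (sym (form-combination (pencil G S t) x b)) (form-0 (pencil G S t) v≋0))) ⟩
        0#              ∎)))
        where
        M N : Carrier → Matrix Carrier (suc k)
        M t = gram (pencil G S t) b b
        N t = updateAt (M t) p (const (combination x (M t)))

      module _ {v} (eigen : ∀ j → form (pencil G S λ₀) v (b j) ≈ 0#) (eigen-v : form (pencil G S λ₀) v v ≈ 0#)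
               (Gvv : 0# < form G v v) (P : Promoted b v) where
        open Promoted P using (others; scale; scale#0; det-gram≈) renaming (spanned to others-spanned)

        Gvv#0 : form G v v # 0#
        Gvv#0 = #-sym (<⇒# Gvv)
        r = proj₁ (inverse Gvv#0)
        Gvv*r = proj₂ (inverse Gvv#0)

        -- Gram-Schmidt: `r` is the inverse of `form G v v`, and `b′` is `others` projected along
        -- `v` onto its G-orthogonal complement.
        coefficient : Fin k → Carrier
        coefficient j = - (form G v (others j) * r)

        b′ : Fin k → Vector Carrier n
        b′ j i = 1# * others j i + coefficient j * v i

        S≈λG : ∀ y → form (pencil G S λ₀) v y ≈ 0# → form S v y ≈ λ₀ * form G v y
        S≈λG y z = begin
          form S v y                                              ≈⟨ +-identityˡ _ ⟨
          0# + form S v y                                         ≈⟨ +-congʳ z ⟨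
          λ₀ * form G v y - form S v y + form S v y               ≈⟨ solve 2 (λ a b → a :- b :+ b := a)
                  refl (λ₀ * form G v y) (form S v y) ⟩
          λ₀ * form G v y                                         ∎

        b′-spanned : ∀ Q z → form Q z v ≈ 0# → (∀ j → form Q z (b j) ≈ 0#) → ∀ j → form Q z (b′ j) ≈ 0#
        b′-spanned Q z zv zb j = begin
          form Q z (b′ j)                                         ≈⟨ form-linearʳ Q 1# (coefficient j) ⟩
          1# * form Q z (others j) + coefficient j * form Q z v   ≈⟨ +-cong (trans (*-identityˡ _) (others-spanned Q z zb j)) (trans (*-congˡ zv) (zeroʳ _)) ⟩
          0# + 0#                                                 ≈⟨ +-identityˡ 0# ⟩
          0#                                                      ∎

        G-v-b′ : ∀ j → form G v (b′ j) ≈ 0#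
        G-v-b′ j = begin
          form G v (b′ j)
            ≈⟨ form-linearʳ G 1# (coefficient j) ⟩
          1# * form G v (others j) + coefficient j * form G v v
            ≈⟨ solve 3 (λ x r g → con 1ℤ :* x :+ :- (x :* r) :* g := x :- x :* (g :* r))
                    refl (form G v (others j)) r (form G v v) ⟩
          form G v (others j) - form G v (others j) * (form G v v * r)
            ≈⟨ +-congˡ (-‿cong (trans (*-congˡ Gvv*r) (*-identityʳ _))) ⟩
          form G v (others j) - form G v (others j)
            ≈⟨ -‿inverseʳ _ ⟩
          0# ∎

        -- On the span of `b` the functional `form S v` is `λ₀` times `form G v`, so G-orthogonality
        -- to `v` implies S-orthogonality.
        S-v-b′ : ∀ j → form S v (b′ j) ≈ 0#
        S-v-b′ j = trans (S≈λG (b′ j) (b′-spanned (pencil G S λ₀) v eigen-v eigen j))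
          (trans (*-congˡ (G-v-b′ j)) (zeroʳ _))

        S-v-v : form S v v ≈ λ₀ * form G v v
        S-v-v = S≈λG v eigen-v

        -- `v` is orthogonal to `b′` for the pencil at every `t`, so the Gram matrix of `v` and `b′`
        -- has a single nonzero candidate in its first row, the corner `(t - λ₀) * form G v v`.
        -- Passing from `b` to this family costs only the factor `scale`, since subtracting
        -- multiples of `v` changes no determinant.
        det-b′ : ∀ t → (t - λ₀) * form G v v * det (gram (pencil G S t) b′ b′)
               ≈ scale * (a * ((t - λ₀) * monic (ev ∘ suc) t))
        det-b′ t = begin
          (t - λ₀) * form G v v * det (gram Q b′ b′)
            ≈⟨ *-congʳ (solve 3 (λ t l g → (t :- l) :* g := t :* g :- l :* g) refl t λ₀ (form G v v)) ⟩
          (t * form G v v - λ₀ * form G v v) * det (gram Q b′ b′)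
            ≈⟨ trans (*-identityˡ _) (*-congʳ (+-congˡ (-‿cong S-v-v))) ⟨
          -- The factor `1#` is the sign of the leading cofactor.
          1# * (form Q v v * det (gram Q b′ b′))
            ≈⟨ ∑-single zero (λ { zero 0≢0 → contradiction ≡.refl 0≢0
                                ; (suc j) _ → trans (*-congˡ (trans (*-congʳ (off j)) (zeroˡ _))) (zeroʳ _) }) ⟨
          ∑ (λ j → -1^ j * (gram Q g g zero j * det (minor (gram Q g g) j)))
            ≈⟨ det-expand ⟨
          det (gram Q g g)
            ≈⟨ det-gram-change Q {b = v Vector.∷ others} {g} {1#} (λ y → trans (det-eliminate (gram Q f y) (gram Q g y) zero
                 (λ j → refl) (op y)) (sym (*-identityˡ _))) ⟩
          1# * 1# * det (gram Q f f)
            ≈⟨ trans (*-congʳ (*-identityˡ 1#)) (*-identityˡ _) ⟩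
          det (gram Q f f)
            ≈⟨ det-gram≈ Q ⟩
          scale * det (gram Q b b)
            ≈⟨ *-congˡ (splits t) ⟩
          scale * (a * ((t - λ₀) * monic (ev ∘ suc) t)) ∎
          where
          Q = pencil G S t
          f = v Vector.∷ others
          g = v Vector.∷ b′
          off : ∀ j → form Q v (b′ j) ≈ 0#
          off j = trans (+-cong (trans (*-congˡ (G-v-b′ j)) (zeroʳ t)) (-‿cong (S-v-b′ j)))
            (-‿inverseʳ 0#)
          op : ∀ y i → ∃[ a ] (∀ j → gram Q g y i j ≈ gram Q f y i j + a * gram Q f y zero j)
          op y zero    = 0# , λ j → sym (trans (+-congˡ (zeroˡ _)) (+-identityʳ _))
          op y (suc i) = coefficient i , λ j → trans (form-linear Q 1# (coefficient i)) (+-congʳ (*-identityˡ _))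

        -- `det-b′` is this identity multiplied by `t - λ₀`; both sides are polynomial in `t`, so
        -- the factor cancels.
        splits′ : Splits b′ (r * (scale * a)) (ev ∘ suc)
        splits′ t = begin
          D t                                  ≈⟨ *-identityˡ _ ⟨
          1# * D t                             ≈⟨ *-congʳ Gvv*r ⟨
          form G v v * r * D t                 ≈⟨ solve 3 (λ g r d → g :* r :* d := r :* (g :* d))
                  refl (form G v v) r (D t) ⟩
          r * (form G v v * D t)               ≈⟨ *-congˡ eq ⟩
          r * (scale * a * m t)                ≈⟨ *-assoc _ _ _ ⟨
          r * (scale * a) * m t                ∎
          where
          D m : Carrier → Carrier
          D t = det (gram (pencil G S t) b′ b′)
          m = monic (ev ∘ suc)
          difference : Carrier → Carrier
          difference t = form G v v * D t + - (scale * a) * m t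
          vanishes : ∀ t → difference t ≈ 0#
          vanishes = cancel-linear
            (polynomial-+ (polynomial-* (polynomial-const _) (polynomial-det λ i j → polynomial-affine _ _))
                          (polynomial-* (polynomial-const _) (polynomial-monic (ev ∘ suc))))
            λ₀ λ t → begin
              (t - λ₀) * difference t
                ≈⟨ solve 6 (λ l g d s a m → l :* (g :* d :+ :- (s :* a) :* m) := l :* g :* d :- s :* (a :* (l :* m)))
                     refl (t - λ₀) (form G v v) (D t) scale a (m t) ⟩
              (t - λ₀) * form G v v * D t - scale * (a * ((t - λ₀) * m t))
                ≈⟨ +-congʳ (det-b′ t) ⟩
              scale * (a * ((t - λ₀) * m t)) - scale * (a * ((t - λ₀) * m t))
                ≈⟨ -‿inverseʳ _ ⟩
              0# ∎
          eq : form G v v * D t ≈ scale * a * m t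
          eq = begin
            form G v v * D t
              ≈⟨ solve 3 (λ x s m → x := x :+ :- s :* m :+ s :* m) refl (form G v v * D t) (scale * a) (m t) ⟩
            difference t + scale * a * m t
              ≈⟨ trans (+-congʳ (vanishes t)) (+-identityˡ _) ⟩
            scale * a * m t ∎

        extend : (v-spanned : ∀ Q z → (∀ j → form Q z (b j) ≈ 0#) → form Q z v ≈ 0#) →
          Eigenbasis b′ (ev ∘ suc) → Eigenbasis b ev
        extend v-spanned E = record
          { vectors      = v Vector.∷ vectors
          ; G-orthogonal = λ {i} {j} → orthogonal G G-v-b′ G-orthogonal i j
          ; S-orthogonal = λ {i} {j} → orthogonal S S-v-b′ S-orthogonal i j
          ; G-pos        = λ { zero → Gvv ; (suc i) → G-pos i }
          ; eigenvalue   = λ { zero → S-v-v ; (suc i) → eigenvalue i }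
          ; spanned      = λ where
              Q z zb zero    → v-spanned Q z zb
              Q z zb (suc i) → spanned Q z (b′-spanned Q z (v-spanned Q z zb) zb) i
          }
          where
          open Eigenbasis E
          orthogonal : ∀ Q → (∀ j → form Q v (b′ j) ≈ 0#) →
            (∀ {i j} → i ≢ j → form Q (vectors i) (vectors j) ≈ 0#) →
            ∀ i j → i ≢ j → form Q ((v Vector.∷ vectors) i) ((v Vector.∷ vectors) j) ≈ 0#
          orthogonal Q vb o zero    zero    i≢j = contradiction ≡.refl i≢j
          orthogonal Q vb o zero    (suc j) i≢j = spanned Q v vb j
          orthogonal Q vb o (suc i) zero    i≢j = trans (form-sym Q) (spanned Q v vb i)
          orthogonal Q vb o (suc i) (suc j) i≢j = o (i≢j ∘ ≡.cong suc)

    eigenbasis : ∀ {k} (b : Fin k → Vector Carrier n) {a} ev → a # 0# → Splits b a ev → ¬ ¬ Eigenbasis b ev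
    eigenbasis {0} b ev a#0 splits k = k record
      { vectors = λ () ; G-orthogonal = λ {} ; S-orthogonal = λ {} ; G-pos = λ () ; eigenvalue = λ () ; spanned = λ _ _ _ () }
    eigenbasis {suc _} b {a} ev a#0 splits k =
      det≈0⇒dependent (gram (pencil G S λ₀) b b) singular λ (x , x#0 , dependency) →
      let v = combination x b
          -- A relation among the rows of the Gram matrix says that `v` is orthogonal to `b` for the
          -- pencil at `λ₀`: an eigenvector relative to the span of `b`.
          eigen = λ j → trans (form-combination (pencil G S λ₀) x b) (dependency j)
          v-spanned = λ Q z zb → trans (form-combinationʳ Q x b) (∑-zero λ i → trans (*-congˡ (zb i)) (zeroʳ (x i)))
          eigen-v = v-spanned (pencil G S λ₀) v eigen
      in G-positive v (independent x x#0) λ Gvv →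
         promote b x x#0 λ P →
         eigenbasis (b′ eigen eigen-v Gvv P) (ev ∘ suc)
           (x#0y#0→xy#0 (inverse-#0 (Gvv*r eigen eigen-v Gvv P)) (x#0y#0→xy#0 (Promoted.scale#0 P) a#0))
           (splits′ eigen eigen-v Gvv P)
           (k ∘ extend eigen eigen-v Gvv P v-spanned)
      where
      open Deflation {b = b} {a} {ev} a#0 splits

  -- Interlacing

  ∑-↑ : ∀ p {q} {f : Fin (p ℕ.+ q) → Carrier} → ∑ f ≈ ∑ (λ i → f (i ↑ˡ q)) + ∑ (λ j → f (p ↑ʳ j))
  ∑-↑ 0       = sym (trans (+-congʳ ∑-empty) (+-identityˡ _))
  ∑-↑ (suc p) = trans ∑-suc (trans (+-congˡ (∑-↑ p)) (trans (sym (+-assoc _ _ _)) (+-congʳ (sym ∑-suc))))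

  Nonzero-↑ : ∀ p {q} (x : Vector Carrier (p ℕ.+ q)) → Nonzero x →
    Nonzero (λ i → x (i ↑ˡ q)) ⊎ Nonzero (λ j → x (p ↑ʳ j))
  Nonzero-↑ p x (i , xi#0) with splitAt p i in eq
  ... | inj₁ j = inj₁ (j , ≡.subst (λ h → x h # 0#) (≡.sym (splitAt⁻¹-↑ˡ eq)) xi#0)
  ... | inj₂ j = inj₂ (j , ≡.subst (λ h → x h # 0#) (≡.sym (splitAt⁻¹-↑ʳ eq)) xi#0)

  combination-zero : ∀ {k n} {x : Vector Carrier k} {b : Fin k → Vector Carrier n} → x ≋ 0ᵛ → combination x b ≋ 0ᵛ
  combination-zero z j = ∑-zero λ i → trans (*-congʳ (z i)) (zeroˡ _)

  module _ {n} (Q : SymmetricForm n) where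
    form-orthogonal : ∀ {k} {b : Fin k → Vector Carrier n} → (∀ {i j} → i ≢ j → form Q (b i) (b j) ≈ 0#) →
      ∀ x i → form Q (combination x b) (b i) ≈ x i * form Q (b i) (b i)
    form-orthogonal {b = b} o x i = trans (form-combination Q x b)
      (∑-single i (λ j j≢i → trans (*-congˡ (o j≢i)) (zeroʳ _)))

    form-diagonal : ∀ {k} {b : Fin k → Vector Carrier n} → (∀ {i j} → i ≢ j → form Q (b i) (b j) ≈ 0#) →
      ∀ x → form Q (combination x b) (combination x b) ≈ ∑ λ i → x i * x i * form Q (b i) (b i)
    form-diagonal {b = b} o x = trans (form-combinationʳ Q x b)
      (∑-cong λ i → trans (*-congˡ (form-orthogonal o x i)) (sym (*-assoc _ _ _)))

    form-opposite : ∀ {x y} → (∀ i → x i + y i ≈ 0#) → form Q x x ≈ form Q y y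
    form-opposite {x} {y} e = begin
      form Q x x                                                      ≈⟨ trans (form-congˡ Q x≋) (form-congʳ Q x≋) ⟩
      form Q -y -y                                                    ≈⟨ trans (form-linear Q (- 1#) 0#) (+-cong (*-congˡ (form-linearʳ Q (- 1#) 0#)) (zeroˡ _)) ⟩
      - 1# * (- 1# * form Q y y + 0# * form Q y y) + 0#               ≈⟨ solve 1 (λ q → :- (con 1ℤ) :* (:- (con 1ℤ) :* q :+ con 0ℤ :* q) :+ con 0ℤ := q)
              refl (form Q y y) ⟩
      form Q y y                                                      ∎
      where
      -y = λ i → - 1# * y i + 0# * y i
      x≋ : x ≋ -y
      x≋ i = begin
        x i                              ≈⟨ solve 2 (λ x y → x := x :+ y :+ (:- (con 1ℤ) :* y :+ con 0ℤ :* y))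
                refl (x i) (y i) ⟩
        x i + y i + -y i                 ≈⟨ trans (+-congʳ (e i)) (+-identityˡ _) ⟩
        -y i                             ∎

  module _ {n p q} (p+q≡1+n : p ℕ.+ q ≡ suc n) (G Q : SymmetricForm n)
    {u : Fin p → Vector Carrier n} {w : Fin q → Vector Carrier n}
    (u-G : ∀ {i j} → i ≢ j → form G (u i) (u j) ≈ 0#) (u-pos : ∀ i → 0# < form G (u i) (u i))
    (u-Q : ∀ {i j} → i ≢ j → form Q (u i) (u j) ≈ 0#) (u-nonpos : ∀ i → 0# ≤ - form Q (u i) (u i))
    (w-Q : ∀ {i j} → i ≢ j → form Q (w i) (w j) ≈ 0#) (w-pos : ∀ i → 0# < form Q (w i) (w i))
    where

    -- A relation gives z = -y, hence equal values of `Q` at `z` and `y`: nonpositive on one side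
    -- and positive on the other unless `β` vanishes. On the `u` side `Q` is only semidefinite, so
    -- `α` is detected by `G` instead.
    independent-families : ∀ α β → Nonzero α ⊎ Nonzero β → ¬ (∀ i → combination α u i + combination β w i ≈ 0#)
    independent-families α β αβ#0 e = ¬Nonzero-α ([ id , (λ b → contradiction b ¬Nonzero-β) ]′ αβ#0)
      where
      z = combination α u
      y = combination β w
      -Qzz-nonneg : 0# ≤ - form Q z z
      -Qzz-nonneg = ≤-resp-≈ refl (begin
          ∑ (λ i → α i * α i * - form Q (u i) (u i))
            ≈⟨ ∑-cong (λ i → solve 2 (λ a q → a :* a :* :- q := :- (con 1ℤ) :* (a :* a :* q))
                    refl (α i) (form Q (u i) (u i))) ⟩
          ∑ (λ i → - 1# * (α i * α i * form Q (u i) (u i)))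
            ≈⟨ *-∑ (- 1#) ⟨
          - 1# * ∑ (λ i → α i * α i * form Q (u i) (u i))
            ≈⟨ trans (-1*x≈-x _) (-‿cong (sym (form-diagonal Q u-Q α))) ⟩
          - form Q z z ∎)
        (∑-nonneg λ i → *-nonneg (square-nonneg (α i)) (u-nonpos i))
      ¬Nonzero-β : ¬ Nonzero β
      ¬Nonzero-β (j , βj#0) = ∑-pos (λ i → *-nonneg (square-nonneg (β i)) (0<⇒0≤ (w-pos i))) j
        (*-pos (square-pos βj#0) (w-pos j))
        λ 0<Qyy → -Qzz-nonneg (<-resp-≈ (+-identityˡ _) (-‿inverseʳ _)
          (<-resp-≈ (+-comm _ _) (+-comm _ _) (+-monoʳ-< (- form Q z z)
            (<-resp-≈ refl (trans (sym (form-diagonal Q w-Q β)) (sym (form-opposite Q e))) 0<Qyy))))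
      ¬Nonzero-α : ¬ Nonzero α
      ¬Nonzero-α (i , αi#0) = vector-#0-or-≈0 β λ where
        (inj₁ β#0) → ¬Nonzero-β β#0
        (inj₂ β≈0) → proj₂ (tight _ _)
          (trans (sym (form-orthogonal G u-G α i)) (form-0 G (λ j →
            trans (sym (trans (+-congˡ (combination-zero {b = w} β≈0 j)) (+-identityʳ _))) (e j))))
          (x#0y#0→xy#0 αi#0 (#-sym (<⇒# (u-pos i))))

    dimensions-exceed : ⊥
    dimensions-exceed = dependent′ p+q≡1+n (u ++ w) λ (x , x#0 , e) →
      independent-families (λ i → x (i ↑ˡ q)) (λ j → x (p ↑ʳ j)) (Nonzero-↑ p x x#0) λ k → trans
        (sym (trans (∑-↑ p) (+-cong
          (∑-cong λ i → *-congˡ (≡⇒≋ (lookup-++ˡ u w i) k))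
          (∑-cong λ j → *-congˡ (≡⇒≋ (lookup-++ʳ u w j) k))))) (e k)
      where
      -- The number of vectors becomes a variable here, so that the equation can be matched with
      -- `refl`.
      dependent′ : ∀ {k n} → k ≡ suc n → (M : Fin k → Vector Carrier n) → ¬ ¬ Dependent M
      dependent′ ≡.refl = dependent _

  -- Since `≤` is a negation, the strict conclusion comes from cotransitivity: `x` is apart from `y`
  -- or from `z`.
  ≤-<-trans : ∀ {x y z} → x ≤ y → y < z → x < z
  ≤-<-trans {x} {y} {z} x≤y y<z = [ via-y , via-z ]′ (#-cotrans (<⇒# y<z) x)
    where
    via-y : y # x → x < z
    via-y y#x = [ (λ y<x → contradiction y<x x≤y) , (λ x<y → SPO.trans x<y y<z) ]′ (#⇒<⊎> y#x)
    via-z : x # z → x < z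
    via-z x#z = [ id , (λ z<x → contradiction (SPO.trans y<z z<x) x≤y) ]′ (#⇒<⊎> x#z)

  Nondecreasing : ∀ {k} → Vector Carrier k → Set ℓ₃
  Nondecreasing ev = ∀ {i j} → i Fin.≤ j → ev i ≤ ev j

  from : ∀ {n} c → c ℕ.≤ n → Fin (n ∸ c) → Fin n
  from c c≤n i = cast (ℕ.m+[n∸m]≡n c≤n) (c ↑ʳ i)

  toℕ-from : ∀ {n} c (c≤n : c ℕ.≤ n) i → toℕ (from c c≤n i) ≡ c ℕ.+ toℕ i
  toℕ-from c c≤n i = ≡.trans (toℕ-cast _ (c ↑ʳ i)) (toℕ-↑ʳ c i)

  module _ {n} (G S : SymmetricForm n) (G-positive : ∀ v → ¬ v ≋ 0ᵛ → ¬ ¬ (0# < form G v v)) where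
    open Eigenbasis

    module _ {k} {b : Fin k → Vector Carrier n} {ev} (E : Eigenbasis G S G-positive b ev) where
      pencil-orthogonal : ∀ s {i j} → i ≢ j → form (pencil G S s) (vectors E i) (vectors E j) ≈ 0#
      pencil-orthogonal s i≢j = trans
        (+-cong (trans (*-congˡ (G-orthogonal E i≢j)) (zeroʳ s)) (-‿cong (S-orthogonal E i≢j))) (-‿inverseʳ 0#)

      pencil-vectors : ∀ s i → form (pencil G S s) (vectors E i) (vectors E i) ≈ (s - ev i) * form G (vectors E i) (vectors E i)
      pencil-vectors s i = trans (+-congˡ (-‿cong (eigenvalue E i)))
        (solve 3 (λ s e g → s :* g :- e :* g := (s :- e) :* g)
                refl s (ev i) (form G (vectors E i) (vectors E i)))

    -- From index `i₁` on, the first basis has k₁ - i₁ vectors with eigenvalue at least `s`; up to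
    -- index `i₂`, the second has i₂ + 1 with eigenvalue below `s`. By `count` these are n + 1
    -- vectors. Exchanging the two bases yields the other interlacing inequality.
    eigenvalue-≤ : ∀ {k₁ k₂} {b₁ : Fin k₁ → Vector Carrier n} {b₂ : Fin k₂ → Vector Carrier n} {ev₁ ev₂} →
      Eigenbasis G S G-positive b₁ ev₁ → Eigenbasis G S G-positive b₂ ev₂ → Nondecreasing ev₁ → Nondecreasing ev₂ →
      ∀ i₁ i₂ → (k₁ ∸ toℕ i₁) ℕ.+ toℕ i₂ ≡ n → ev₁ i₁ ≤ ev₂ i₂
    eigenvalue-≤ {k₁} {k₂} {ev₁ = ev₁} {ev₂} E₁ E₂ mono₁ mono₂ i₁ i₂ count ev₂<ev₁ =
      dimensions-exceed (≡.trans (ℕ.+-suc (k₁ ∸ toℕ i₁) (toℕ i₂)) (≡.cong suc count)) G (pencil G S s)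
        {u = vectors E₁ ∘ f} {w = vectors E₂ ∘ g}
        (λ i≢j → G-orthogonal E₁ (i≢j ∘ f-injective)) (λ i → G-pos E₁ (f i))
        (λ i≢j → pencil-orthogonal E₁ s (i≢j ∘ f-injective))
        (λ i → ≤-resp-≈ refl
          (trans (solve 3 (λ s e g → (e :- s) :* g := :- ((s :- e) :* g))
                  refl s (ev₁ (f i)) (form G (vectors E₁ (f i)) (vectors E₁ (f i))))
                 (-‿cong (sym (pencil-vectors E₁ s (f i)))))
          (*-nonneg (sub-nonneg (mono₁ (f-≥ i))) (0<⇒0≤ (G-pos E₁ (f i)))))
        (λ i≢j → pencil-orthogonal E₂ s (i≢j ∘ g-injective))
        (λ j → <-resp-≈ refl (sym (pencil-vectors E₂ s (g j)))
          (*-pos (sub-pos (≤-<-trans (mono₂ (g-≤ j)) ev₂<ev₁)) (G-pos E₂ (g j))))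
      where
      -- No midpoint is required: strictness is needed only on the `ev₂` side.
      s = ev₁ i₁
      f : Fin (k₁ ∸ toℕ i₁) → Fin k₁
      f = from (toℕ i₁) (ℕ.<⇒≤ (toℕ<n i₁))
      toℕ-f : ∀ i → toℕ (f i) ≡ toℕ i₁ ℕ.+ toℕ i
      toℕ-f = toℕ-from (toℕ i₁) (ℕ.<⇒≤ (toℕ<n i₁))
      f-injective : Injective _≡_ _≡_ f
      f-injective {i} {j} e = toℕ-injective (ℕ.+-cancelˡ-≡ (toℕ i₁) _ _
        (≡.trans (≡.sym (toℕ-f i)) (≡.trans (≡.cong toℕ e) (toℕ-f j))))
      f-≥ : ∀ i → i₁ Fin.≤ f i
      f-≥ i = ≡.subst (toℕ i₁ ℕ.≤_) (≡.sym (toℕ-f i)) (ℕ.m≤m+n (toℕ i₁) (toℕ i))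
      g : Fin (suc (toℕ i₂)) → Fin k₂
      g j = inject≤ j (toℕ<n i₂)
      toℕ-g : ∀ j → toℕ (g j) ≡ toℕ j
      toℕ-g j = toℕ-inject≤ j (toℕ<n i₂)
      g-injective : Injective _≡_ _≡_ g
      g-injective {i} {j} e = toℕ-injective (≡.trans (≡.sym (toℕ-g i)) (≡.trans (≡.cong toℕ e) (toℕ-g j)))
      g-≤ : ∀ j → g j Fin.≤ i₂
      g-≤ j = ≡.subst (ℕ._≤ toℕ i₂) (≡.sym (toℕ-g j)) (toℕ≤pred[n] j)

  -- Forms of integer matrices on coordinate space

  dot : ∀ n → SymmetricForm n
  dot n = record
    { form        = λ x y → ∑ λ i → x i * y i
    ; form-congˡ  = λ e → ∑-cong λ i → *-congʳ (e i)
    ; form-linear = λ a b {x} {y} {z} → trans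
        (∑-cong λ i → solve 5 (λ a b x y z → (a :* x :+ b :* y) :* z := a :* (x :* z) :+ b :* (y :* z))
                refl a b (x i) (y i) (z i))
        (∑-linear a b)
    ; form-sym    = ∑-cong λ i → *-comm _ _
    }

  dot-positive : ∀ {n} (v : Vector Carrier n) → ¬ v ≋ 0ᵛ → ¬ ¬ (0# < form (dot n) v v)
  dot-positive v v≉0 k = vector-#0-or-≈0 v λ where
    (inj₂ v≈0)        → v≉0 v≈0
    (inj₁ (i , vi#0)) → ∑-pos (λ i → square-nonneg (v i)) i (square-pos vi#0) k

  unit : ∀ {n} → Fin n → Vector Carrier n
  unit p i = if does (p ≟ i) then 1# else 0#

  ∑-unit : ∀ {n} p (f : Fin n → Carrier) → ∑ (λ i → unit p i * f i) ≈ f p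
  ∑-unit p f = trans (∑-single p (λ i i≢p → trans (*-congʳ (off i i≢p)) (zeroˡ _)))
    (trans (*-congʳ at) (*-identityˡ _))
    where
    off : ∀ i → i ≢ p → unit p i ≈ 0#
    off i i≢p with p ≟ i
    ... | yes p≡i = contradiction (≡.sym p≡i) i≢p
    ... | no  _   = refl
    at : unit p p ≈ 1#
    at with p ≟ p
    ... | yes _   = refl
    ... | no  p≢p = contradiction ≡.refl p≢p

  module _ {n} (B : Matrix ℤ n) (B-sym : ∀ i j → B i j ≡ B j i) where
    matrixForm : SymmetricForm n
    matrixForm = record
      { form        = λ x y → ∑ λ i → x i * ∑ λ j → y j * fromℤ (B i j)
      ; form-congˡ  = λ e → ∑-cong λ i → *-congʳ (e i)
      ; form-linear = λ a b {x} {y} {z} → trans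
          (∑-cong λ i → solve 5 (λ a b x y z → (a :* x :+ b :* y) :* z := a :* (x :* z) :+ b :* (y :* z))
                  refl a b (x i) (y i)
            (∑ λ j → z j * fromℤ (B i j)))
          (∑-linear a b)
      ; form-sym    = λ {x} {y} → begin
          ∑ (λ i → x i * ∑ (λ j → y j * fromℤ (B i j)))  ≈⟨ ∑-cong (λ i → *-∑ (x i)) ⟩
          ∑ (λ i → ∑ (λ j → x i * (y j * fromℤ (B i j)))) ≈⟨ ∑-swap ⟩
          ∑ (λ j → ∑ (λ i → x i * (y j * fromℤ (B i j)))) ≈⟨ ∑-cong (λ j → ∑-cong λ i → trans
                                                              (solve 3 (λ x y b → x :* (y :* b) := y :* (x :* b))
                                                                      refl (x i) (y j) (fromℤ (B i j)))
                                                              (*-congˡ (*-congˡ (reflexive (≡.cong fromℤ (B-sym i j)))))) ⟩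
          ∑ (λ j → ∑ (λ i → y j * (x i * fromℤ (B j i)))) ≈⟨ ∑-cong (λ j → *-∑ (y j)) ⟨
          ∑ (λ j → y j * ∑ (λ i → x i * fromℤ (B j i))) ∎
      }

    -- The Gram matrix of the pencil on the coordinate vectors chosen by `e` is the characteristic
    -- matrix of the submatrix. Deflation thus starts with constant `1#`, inside the same n-space
    -- for every `e`.
    splits-units : ∀ {m} (e : Fin m → Fin n) → Injective _≡_ _≡_ e → ∀ {ev} →
      AreEigenvalues (λ i j → B (e i) (e j)) ev → Splits (dot n) matrixForm dot-positive (unit ∘ e) 1# ev
    splits-units e e-injective {ev} A t = begin
      det (gram (pencil (dot n) matrixForm t) (unit ∘ e) (unit ∘ e))
        ≈⟨ det-cong (λ i j → +-cong
             (trans (*-congˡ (∑-unit (e i) (unit (e j)))) (diagonal i j))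
             (-‿cong (trans (∑-unit (e i) _) (∑-unit (e j) _)))) ⟩
      det (λ i j → scalar t i j - fromℤ (B (e i) (e j)))
        ≈⟨ det≈ (λ i j → scalar t i j - fromℤ (B (e i) (e j))) ⟩
      E.det (λ i j → scalar t i j - fromℤ (B (e i) (e j)))
        ≈⟨ AreEigenvalues.splits A t ⟩
      monic ev t
        ≈⟨ *-identityˡ _ ⟨
      1# * monic ev t ∎
      where
      diagonal : ∀ i j → t * unit (e j) (e i) ≈ scalar t i j
      diagonal i j with i ≟ j | e j ≟ e i
      ... | yes _      | yes _  = *-identityʳ t
      ... | no  _      | no  _  = zeroʳ t
      ... | yes ≡.refl | no ne  = contradiction ≡.refl ne
      ... | no  i≢j    | yes eq = contradiction (≡.sym (e-injective eq)) i≢j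

    principal-submatrix-interlaces : ∀ {m} (m≤n : m ℕ.≤ n) (e : Fin m → Fin n) → Injective _≡_ _≡_ e →
      EigenvaluesInterlace F m≤n (λ i j → B (e i) (e j)) B
    principal-submatrix-interlaces {m} m≤n e e-injective μ ν A N k =
      (λ lt → with-bases λ E₁ E₂ → eigenvalue-≤ (dot n) matrixForm dot-positive E₂ E₁ N.nondecreasing A.nondecreasing
        (inject≤ k m≤n) k lower lt) ,
      (λ lt → with-bases λ E₁ E₂ → eigenvalue-≤ (dot n) matrixForm dot-positive E₁ E₂ A.nondecreasing N.nondecreasing
        k k″ upper lt)
      where
      module A = AreEigenvalues A
      module N = AreEigenvalues N
      k″ = cast (ℕ.m∸n+n≡m m≤n) ((n ∸ m) ↑ʳ k)
      -- Each inequality is a negation, so its proof ends in `⊥` and may use the doubly negated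
      -- bases.
      with-bases : (Eigenbasis (dot n) matrixForm dot-positive (unit ∘ e) μ →
                    Eigenbasis (dot n) matrixForm dot-positive unit ν → ⊥) → ⊥
      with-bases h =
        eigenbasis (dot n) matrixForm dot-positive (unit ∘ e) μ 1#0 (splits-units e e-injective A) λ E₁ →
        eigenbasis (dot n) matrixForm dot-positive unit ν 1#0 (splits-units id id N) λ E₂ → h E₁ E₂
      lower : (n ∸ toℕ (inject≤ k m≤n)) ℕ.+ toℕ k ≡ n
      lower = ≡.trans (≡.cong (λ i → (n ∸ i) ℕ.+ toℕ k) (toℕ-inject≤ k m≤n))
        (ℕ.m∸n+n≡m (ℕ.≤-trans (ℕ.<⇒≤ (toℕ<n k)) m≤n))
      upper : (m ∸ toℕ k) ℕ.+ toℕ k″ ≡ n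
      upper = ≡.trans
        (≡.cong ((m ∸ toℕ k) ℕ.+_) (≡.trans (toℕ-cast _ ((n ∸ m) ↑ʳ k)) (toℕ-↑ʳ (n ∸ m) k)))
        ([m∸k]+[[n∸m]+k]≡n (ℕ.<⇒≤ (toℕ<n k)) m≤n)

-- Restriction to sets of simplices

elements-injective : ∀ {n} (A : Subset n) → Injective _≡_ _≡_ (elements A)
elements-injective (inside  ∷ A) {zero}  {zero}  e = ≡.refl
elements-injective (inside  ∷ A) {suc a} {suc b} e = ≡.cong suc (elements-injective A (suc-injective e))
elements-injective (outside ∷ A)                 e = elements-injective A (suc-injective e)

theorem2 : ∀ {c ℓ₁ ℓ₂ ℓ₃} (F : OrderedField c ℓ₁ ℓ₂ ℓ₃) {N n : ℕ}
    (G : SimplicialComplex N n) (o : VertexOrderings G) →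
    (∀ (K : Subset n) → IsSubcomplex G K →
    EigenvaluesInterlace F (∣p∣≤n K) (diracOn o K) (dirac o)) ×
    (∀ (U : Subset n) → IsOpen G U →
    EigenvaluesInterlace F (∣p∣≤n U) (diracOn o U) (dirac o))
theorem2 F {n = n} G o = (λ K _ → interlaces K) , (λ U _ → interlaces U)
  where
  -- `diracOn o A` unfolds to the entries of `dirac o` at the indices `elements A`, and `d` plus its
  -- transpose is symmetric by commutativity of addition.
  interlaces : (A : Subset n) → EigenvaluesInterlace F (∣p∣≤n A) (diracOn o A) (dirac o)
  interlaces A = Interlacing.principal-submatrix-interlaces F (dirac o)
    (λ i j → ℤ.+-comm (d o i j) (d o j i)) (∣p∣≤n A) (elements A) (elements-injective A)
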